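{- For every $k\ge 1$ there is a set $\mathcal{Q}_k\subseteq\mathcal{S}_k$ with $|\mathcal{Q}_k|=(1-o(1))k!$ (as $k\to\infty$) such that, if $\sigma$ is a uniformly random permutation of length $n=20k^2$, then with probability $1-o(1)$ as $k\to\infty$, $\sigma$ contains every $\pi\in\mathcal{Q}_k$.
   Context: $\mathcal{S}_n$ denotes the set of permutations of $[n]=\{1,\dots,n\}$. A permutation $\sigma\in\mathcal{S}_n$ contains a pattern $\pi\in\mathcal{S}_k$ if there are indices $1\le x_1<\dots<x_k\le n$ such that for all $1\le i,j\le k$, $\sigma(x_i)<\sigma(x_j)$ if and only if $\pi(i)<\pi(j)$. (In the paper the set is explicit: $\mathcal{Q}_k$ is the set of $\pi\in\mathcal{S}_k$ with $L_\Delta(\pi)\le 3\sqrt{k}$ for all $\Delta\in[k]$, where $L_\Delta(\pi)$ is the largest $L$ for which there exist $L$-element sets $A=\{a_1<\dots<a_L\}$, $B=\{b_1<\dots<b_L\}\subseteq[k]$ with $\pi(a_i)=\pi(b_i)+\Delta$ for all $i$.) -}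

module Defs where

open import Data.Nat using (ℕ; _*_)
open import Data.Fin using (Fin; _<_)
open import Data.Vec using (Vec; lookup)
open import Data.Product using (Σ; _×_)
open import Function.Bundles using (_⇔_)
open import Relation.Binary.PropositionalEquality using (_≡_)

-- A permutation of [n] is represented by its one-line notation
-- (σ(1),…,σ(n)) as a vector of elements of Fin n which is injective
-- (hence a bijection of Fin n).
IsPerm : {n : ℕ} → Vec (Fin n) n → Set
IsPerm {n} σ = (i j : Fin n) → lookup σ i ≡ lookup σ j → i ≡ j

Contains : {n k : ℕ} → Vec (Fin n) n → Vec (Fin k) k → Set
Contains {n} {k} σ π =
  Σ (Fin k → Fin n) λ x →
    ((i j : Fin k) → i < j → x i < x j) ×
    ((i j : Fin k) → (lookup σ (x i) < lookup σ (x j)) ⇔ (lookup π i < lookup π j))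

len : ℕ → ℕ
len k = 20 * (k * k)

{-# OPTIONS --safe #-}

-- With s of order log k, cut the values of σ into k + s horizontal strips and its
-- positions into 2k columns. For each shift Δ < s, look greedily, from left to right, for a
-- point of σ in strip π(1) + Δ, then in strip π(2) + Δ in a later column, and so on.
-- If all shifts fail, each of them meets at least k empty cells. Two searches meet a
-- common empty cell only along a common subsequence of the two target sequences; for
-- most π these are short (a common subsequence determines the values of π on its
-- positions from the others), and in a typical σ no strip is empty in more than s
-- consecutive columns. So about ks distinct cells are empty, which has probability
-- 2^(-Ω(ks)), small compared with 1/k!.
--
-- To have independent cells, σ is replaced by a word v ∘ σ over a large alphabet with
-- v increasing: (v , σ) ↦ v ∘ σ is injective and reaches at least half of all words.
module Submission where

open import Defs
open import Data.Nat using (ℕ; zero; suc; _+_; _*_; _∸_; _^_; _/_; _%_; _⊔_; _≤_; _<_; z≤n; s≤s; s≤s⁻¹; NonZero; >-nonZero; ⌊_/2⌋; ⌈_/2⌉)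
open import Data.Nat using (_!)
open import Data.Nat.DivMod using (m≡m%n+[m/n]*n; m%n<n; m/n*n≤m; m≥n⇒m/n>0)
open import Data.Nat.Induction using (<-wellFounded)
open import Data.Nat.Properties renaming (_≟_ to _≟ℕ_)
open import Data.Nat.Tactic.RingSolver using (solve-∀)
open import Data.Bool using (if_then_else_)
open import Data.Fin as Fin using (Fin; zero; suc; _≟_; toℕ; fromℕ<; punchIn; punchOut; combine; remQuot; cast)
open import Data.Fin.Properties using (any?; all?; toℕ-injective; toℕ-fromℕ<; toℕ<n; toℕ-cast; punchIn-injective; punchInᵢ≢i; punchIn-punchOut; punchOut-injective; injective⇒≤; ¬∀⟶∃¬; combine-monoˡ-<; combine-surjective; combine-remQuot; cast-involutive) renaming (suc-injective to Fin-suc-injective; <-cmp to Fin-<-cmp; <-irrefl to Fin-<-irrefl; _<?_ to _Fin<?_)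
open import Data.Vec as Vec using (Vec; []; _∷_; lookup; toList)
open import Data.Vec.Properties using (∷-injective; lookup-map; lookup∘tabulate; tabulate∘lookup; tabulate-cong; length-toList)
open import Data.List using (List; []; _∷_; _++_; length; map; filter; cartesianProductWith; cartesianProduct; allFin; tabulate)
open import Data.List.Properties using (length-++; length-map; length-tabulate; length-filter; filter-none)
open import Data.List.Membership.Propositional using (_∈_; _∉_; lose; find)
open import Data.List.Membership.Propositional.Properties using (∈-∃++; ∈-++⁻; ∈-++⁺ˡ; ∈-++⁺ʳ; ∈-allFin; ∈-map⁺; ∈-map⁻; ∈-filter⁺; ∈-filter⁻; ∈-cartesianProductWith⁺; ∈-cartesianProductWith⁻; ∈-cartesianProduct⁺; ∈-cartesianProduct⁻)
open import Data.List.Membership.DecPropositional using (_∈?_)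
open import Data.List.Relation.Unary.Any as Any using (Any; here; there)
open import Data.List.Relation.Unary.All as All using (All; []; _∷_)
import Data.List.Relation.Unary.All.Properties as All
open import Data.List.Relation.Unary.AllPairs using (AllPairs; []; _∷_)
import Data.List.Relation.Unary.AllPairs.Properties as AllPairs
open import Data.List.Relation.Unary.Unique.Propositional using (Unique)
import Data.List.Relation.Unary.Unique.Propositional.Properties as Unique
open import Data.Product using (Σ; ∃; ∃₂; _×_; _,_; proj₁; proj₂; uncurry)
open import Data.Sum using (_⊎_; inj₁; inj₂)
open import Data.Unit using (⊤; tt)
open import Data.Empty using (⊥-elim)
open import Function.Bundles using (mk⇔)
open import Induction.WellFounded using (Acc; acc)
open import Relation.Nullary using (Dec; yes; no; ¬_; ¬?)
open import Relation.Nullary.Decidable using (⌊_⌋; _×-dec_; _→-dec_)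
open import Relation.Unary using (Decidable)
open import Relation.Binary using (tri<; tri≈; tri>)
open import Relation.Binary.PropositionalEquality

-- A single search fails with probability about `2^(-Ω(k))`, too much for a union bound over nearly
-- `k!` patterns; hence about `log k` searches at once, and hence the need for their empty cells to
-- be distinct. Which cells are inspected depends on the word, so the count of empty ones is
-- controlled through an exponential weight that is averaged column by column.
--
-- The base 64 is `2^6`: a column has `10 * k` letters, at least six times the number `R = k + s` of
-- strips, and `(1 - 1/R)^(6R) ≤ 2^(-6)`. With `k < 2^t` and `s = 2t`, half of the `s * k` misses
-- may be lost to overlaps, which leaves `U = t * k`. The gain `64^U = 2^(6tk)` is spent as
-- `2^(4tk)` on the mean weight over `2k` columns, `2^(tk)` on `k!` and `2^(tk)` on `4m`.
--
-- The allowed length of common subsequences is `k` over a power of `log k`. It must be at most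
-- about `k / (2 s^2)` to keep the overlaps small, and at least of order `k^(2/3)` for the count of
-- exceptional patterns.

private variable A B X : Set

-- Finite sums and counting

∑ : List A → (A → ℕ) → ℕ
∑ []       f = 0
∑ (x ∷ xs) f = f x + ∑ xs f

∑-cong : (xs : List A) {f g : A → ℕ} → (∀ x → f x ≡ g x) → ∑ xs f ≡ ∑ xs g
∑-cong []       e = refl
∑-cong (x ∷ xs) e = cong₂ _+_ (e x) (∑-cong xs e)

∑-mono-∈ : (xs : List A) {f g : A → ℕ} → (∀ {x} → x ∈ xs → f x ≤ g x) → ∑ xs f ≤ ∑ xs g
∑-mono-∈ []       h = z≤n
∑-mono-∈ (x ∷ xs) h = +-mono-≤ (h (here refl)) (∑-mono-∈ xs (λ p → h (there p)))

∑-mono : (xs : List A) {f g : A → ℕ} → (∀ x → f x ≤ g x) → ∑ xs f ≤ ∑ xs g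
∑-mono xs h = ∑-mono-∈ xs (λ {x} _ → h x)

∑-++ : (xs ys : List A) (f : A → ℕ) → ∑ (xs ++ ys) f ≡ ∑ xs f + ∑ ys f
∑-++ []       ys f = refl
∑-++ (x ∷ xs) ys f = trans (cong (f x +_) (∑-++ xs ys f)) (sym (+-assoc (f x) _ _))

∑-map : (xs : List A) (h : A → B) (f : B → ℕ) → ∑ (map h xs) f ≡ ∑ xs (λ x → f (h x))
∑-map []       h f = refl
∑-map (x ∷ xs) h f = cong (f (h x) +_) (∑-map xs h f)

∑-+ : (xs : List A) (f g : A → ℕ) → ∑ xs (λ x → f x + g x) ≡ ∑ xs f + ∑ xs g
∑-+ []       f g = refl
∑-+ (x ∷ xs) f g rewrite ∑-+ xs f g = swap (f x) (g x) (∑ xs f) (∑ xs g)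
  where
  swap : ∀ a b c d → a + b + (c + d) ≡ a + c + (b + d)
  swap = solve-∀

∑-*ˡ : (xs : List A) (c : ℕ) (f : A → ℕ) → ∑ xs (λ x → c * f x) ≡ c * ∑ xs f
∑-*ˡ []       c f = sym (*-zeroʳ c)
∑-*ˡ (x ∷ xs) c f = trans (cong (c * f x +_) (∑-*ˡ xs c f)) (sym (*-distribˡ-+ c (f x) _))

∑-*ʳ : (xs : List A) (c : ℕ) (f : A → ℕ) → ∑ xs (λ x → f x * c) ≡ ∑ xs f * c
∑-*ʳ xs c f = trans (∑-cong xs (λ x → *-comm (f x) c)) (trans (∑-*ˡ xs c f) (*-comm c _))

∑-const : (xs : List A) (c : ℕ) → ∑ xs (λ _ → c) ≡ length xs * c
∑-const []       c = refl
∑-const (x ∷ xs) c = cong (c +_) (∑-const xs c)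

∑-swap : (xs : List A) (ys : List B) (f : A → B → ℕ) →
         ∑ xs (λ x → ∑ ys (f x)) ≡ ∑ ys (λ y → ∑ xs (λ x → f x y))
∑-swap []       ys f = sym (trans (∑-const ys 0) (*-zeroʳ (length ys)))
∑-swap (x ∷ xs) ys f = trans (cong (∑ ys (f x) +_) (∑-swap xs ys f)) (sym (∑-+ ys (f x) _))

∑-∈ : {xs : List A} {x : A} (f : A → ℕ) → x ∈ xs → f x ≤ ∑ xs f
∑-∈ f (here refl) = m≤m+n _ _
∑-∈ f (there p)   = ≤-trans (∑-∈ f p) (m≤n+m _ _)

∑-cartesianProductWith : (h : A → B → X) (xs : List A) (ys : List B) (f : X → ℕ) →
  ∑ (cartesianProductWith h xs ys) f ≡ ∑ xs (λ x → ∑ ys (λ y → f (h x y)))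
∑-cartesianProductWith h []       ys f = refl
∑-cartesianProductWith h (x ∷ xs) ys f =
  trans (∑-++ (map (h x) ys) _ f) (cong₂ _+_ (∑-map ys (h x) f) (∑-cartesianProductWith h xs ys f))

length≡∑1 : (xs : List A) → length xs ≡ ∑ xs (λ _ → 1)
length≡∑1 xs = sym (trans (∑-const xs 1) (*-identityʳ _))

length-cartesianProductWith : (h : A → B → X) (xs : List A) (ys : List B) →
  length (cartesianProductWith h xs ys) ≡ length xs * length ys
length-cartesianProductWith h xs ys = begin
  length (cartesianProductWith h xs ys)        ≡⟨ length≡∑1 (cartesianProductWith h xs ys) ⟩
  ∑ (cartesianProductWith h xs ys) (λ _ → 1)   ≡⟨ ∑-cartesianProductWith h xs ys _ ⟩
  ∑ xs (λ _ → ∑ ys (λ _ → 1))                  ≡⟨ ∑-const xs _ ⟩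
  length xs * ∑ ys (λ _ → 1)                   ≡⟨ cong (length xs *_) (length≡∑1 ys) ⟨
  length xs * length ys                        ∎
  where open ≡-Reasoning

indicator : {P : Set} → Dec P → ℕ
indicator (yes _) = 1
indicator (no  _) = 0

module _ {P : A → Set} (P? : Decidable P) where

  length-filter≡∑ : ∀ xs → length (filter P? xs) ≡ ∑ xs (λ x → indicator (P? x))
  length-filter≡∑ []       = refl
  length-filter≡∑ (x ∷ xs) with P? x
  ... | yes _ = cong suc (length-filter≡∑ xs)
  ... | no  _ = length-filter≡∑ xs

  length-filter-complement : ∀ xs →
    length (filter P? xs) + length (filter (λ x → ¬? (P? x)) xs) ≡ length xs
  length-filter-complement []       = refl
  length-filter-complement (x ∷ xs) with P? x
  ... | yes _ = cong suc (length-filter-complement xs)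
  ... | no  _ = trans (+-suc _ _) (cong suc (length-filter-complement xs))

markov : {P : A → Set} (P? : Decidable P) (t : ℕ) (f : A → ℕ) → (∀ {x} → P x → t ≤ f x) →
         ∀ xs → length (filter P? xs) * t ≤ ∑ xs f
markov P? t f h []       = z≤n
markov P? t f h (x ∷ xs) with P? x
... | yes p = +-mono-≤ (h p) (markov P? t f h xs)
... | no  _ = ≤-trans (markov P? t f h xs) (m≤n+m _ _)

union-bound : {P : A → B → Set} (P? : ∀ x y → Dec (P x y)) (xs : List A) (ys : List B) →
  (∀ {x} → x ∈ xs → ∃ λ y → y ∈ ys × P x y) →
  length xs ≤ ∑ ys (λ y → length (filter (λ x → P? x y) xs))
union-bound P? xs ys cover = begin
  length xs                                          ≡⟨ length≡∑1 xs ⟩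
  ∑ xs (λ _ → 1)                                     ≤⟨ ∑-mono-∈ xs pointwise ⟩
  ∑ xs (λ x → ∑ ys (λ y → indicator (P? x y)))       ≡⟨ ∑-swap xs ys _ ⟩
  ∑ ys (λ y → ∑ xs (λ x → indicator (P? x y)))       ≡⟨ ∑-cong ys (λ y → sym (length-filter≡∑ (λ x → P? x y) xs)) ⟩
  ∑ ys (λ y → length (filter (λ x → P? x y) xs))     ∎
  where
  open ≤-Reasoning
  pointwise : ∀ {x} → x ∈ xs → 1 ≤ ∑ ys (λ y → indicator (P? x y))
  pointwise {x} x∈ with cover x∈
  ... | y , y∈ , p = ≤-trans positive (∑-∈ (λ y → indicator (P? x y)) y∈)
    where
    positive : 1 ≤ indicator (P? x y)
    positive with P? x y
    ... | yes _ = ≤-refl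
    ... | no ¬p = ⊥-elim (¬p p)

injection⇒length≤ : (f : A → B) {xs : List A} {ys : List B} → Unique xs →
  (∀ {x y} → x ∈ xs → y ∈ xs → f x ≡ f y → x ≡ y) →
  (∀ {x} → x ∈ xs → f x ∈ ys) → length xs ≤ length ys
injection⇒length≤ f {[]} [] inj sub = z≤n
injection⇒length≤ f {x ∷ xs} (x∉ ∷ u) inj sub with ∈-∃++ (sub (here refl))
... | as , bs , refl = begin
  suc (length xs)             ≤⟨ s≤s (injection⇒length≤ f u (λ p q → inj (there p) (there q)) sub′) ⟩
  suc (length (as ++ bs))     ≡⟨ cong suc (length-++ as) ⟩
  suc (length as + length bs) ≡⟨ +-suc (length as) (length bs) ⟨
  length as + suc (length bs) ≡⟨ length-++ as ⟨
  length (as ++ f x ∷ bs)     ∎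
  where
  open ≤-Reasoning
  sub′ : ∀ {y} → y ∈ xs → f y ∈ as ++ bs
  sub′ y∈ with ∈-++⁻ as (sub (there y∈))
  ... | inj₁ p         = ∈-++⁺ˡ p
  ... | inj₂ (there p) = ∈-++⁺ʳ as p
  ... | inj₂ (here e)  = ⊥-elim (All.lookup x∉ y∈ (inj (here refl) (there y∈) (sym e)))

-- Vectors over a finite list, and product weights

vecs : List A → ∀ n → List (Vec A n)
vecs xs zero    = [] ∷ []
vecs xs (suc n) = cartesianProductWith _∷_ xs (vecs xs n)

∈-vecs : {xs : List A} → (∀ x → x ∈ xs) → ∀ {n} (v : Vec A n) → v ∈ vecs xs n
∈-vecs all []      = here refl
∈-vecs all (x ∷ v) = ∈-cartesianProductWith⁺ _∷_ (all x) (∈-vecs all v)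

length-vecs : (xs : List A) → ∀ n → length (vecs xs n) ≡ length xs ^ n
length-vecs xs zero    = refl
length-vecs xs (suc n) = trans (length-cartesianProductWith _∷_ xs (vecs xs n)) (cong (length xs *_) (length-vecs xs n))

∏ᵛ : (A → ℕ) → ∀ {n} → Vec A n → ℕ
∏ᵛ g []      = 1
∏ᵛ g (x ∷ v) = g x * ∏ᵛ g v

∏ᵛ-* : (f g : A → ℕ) → ∀ {n} (v : Vec A n) → ∏ᵛ (λ x → f x * g x) v ≡ ∏ᵛ f v * ∏ᵛ g v
∏ᵛ-* f g []      = refl
∏ᵛ-* f g (x ∷ v) rewrite ∏ᵛ-* f g v = [m*n]*[o*p]≡[m*o]*[n*p] (f x) (g x) (∏ᵛ f v) (∏ᵛ g v)

-- Independence of the entries of a uniform vector, in unnormalised form: the mean of a product is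
-- the product of the means.
∑-vecs-∏ᵛ : (xs : List A) (g : A → ℕ) → ∀ n → ∑ (vecs xs n) (∏ᵛ g) ≡ ∑ xs g ^ n
∑-vecs-∏ᵛ xs g zero    = refl
∑-vecs-∏ᵛ xs g (suc n) = begin
  ∑ (vecs xs (suc n)) (∏ᵛ g)                          ≡⟨ ∑-cartesianProductWith _∷_ xs (vecs xs n) _ ⟩
  ∑ xs (λ x → ∑ (vecs xs n) (λ v → g x * ∏ᵛ g v))     ≡⟨ ∑-cong xs (λ x → ∑-*ˡ (vecs xs n) (g x) (∏ᵛ g)) ⟩
  ∑ xs (λ x → g x * ∑ (vecs xs n) (∏ᵛ g))             ≡⟨ ∑-*ʳ xs _ g ⟩
  ∑ xs g * ∑ (vecs xs n) (∏ᵛ g)                       ≡⟨ cong (∑ xs g *_) (∑-vecs-∏ᵛ xs g n) ⟩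
  ∑ xs g ^ suc n                                      ∎
  where open ≡-Reasoning

-- The greedy search in a random grid word

^-distribʳ-* : ∀ a b n → (a * b) ^ n ≡ a ^ n * b ^ n
^-distribʳ-* a b zero    = refl
^-distribʳ-* a b (suc n) rewrite ^-distribʳ-* a b n = [m*n]*[o*p]≡[m*o]*[n*p] a b (a ^ n) (b ^ n)

-- Bernoulli's `(1 + 1/x)^h ≥ 1 + h/x` with denominators cleared.
x^h*[x+h]≤[1+x]^h*x : ∀ x h → x ^ h * (x + h) ≤ suc x ^ h * x
x^h*[x+h]≤[1+x]^h*x x zero    = ≤-reflexive (cong (1 *_) (+-identityʳ x))
x^h*[x+h]≤[1+x]^h*x x (suc h) = begin
  x * x ^ h * (x + suc h)                ≤⟨ m≤m+n _ (x ^ h * h) ⟩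
  x * x ^ h * (x + suc h) + x ^ h * h    ≡⟨ expand x (x ^ h) h ⟩
  suc x * (x ^ h * (x + h))              ≤⟨ *-monoʳ-≤ (suc x) (x^h*[x+h]≤[1+x]^h*x x h) ⟩
  suc x * (suc x ^ h * x)                ≡⟨ *-assoc (suc x) (suc x ^ h) x ⟨
  suc x ^ suc h * x                      ∎
  where
  open ≤-Reasoning
  expand : ∀ a b c → a * b * (a + suc c) + b * c ≡ suc a * (b * (a + c))
  expand = solve-∀

2*x^h≤[1+x]^h : ∀ x h → x < h → 2 * x ^ h ≤ suc x ^ h
2*x^h≤[1+x]^h zero      (suc h) _ = z≤n
2*x^h≤[1+x]^h x@(suc _) h       p = *-cancelʳ-≤ (2 * x ^ h) (suc x ^ h) x (begin
  2 * x ^ h * x     ≡⟨ double x (x ^ h) ⟩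
  x ^ h * (x + x)   ≤⟨ *-monoʳ-≤ (x ^ h) (+-monoʳ-≤ x (<⇒≤ p)) ⟩
  x ^ h * (x + h)   ≤⟨ x^h*[x+h]≤[1+x]^h*x x h ⟩
  suc x ^ h * x     ∎)
  where
  open ≤-Reasoning
  double : ∀ a b → 2 * b * a ≡ b * (a + a)
  double = solve-∀

-- Each of six blocks of `suc x` factors gains a factor 2; the remaining `e` factors need only
-- monotonicity.
64*x^h≤[1+x]^h : ∀ x h → suc x * 6 ≤ h → 64 * x ^ h ≤ suc x ^ h
64*x^h≤[1+x]^h x h p = begin
  64 * x ^ h                       ≡⟨ cong (λ z → 64 * x ^ z) (m+[n∸m]≡n p) ⟨
  64 * x ^ (d * 6 + e)             ≡⟨ cong (64 *_) (^-distribˡ-+-* x (d * 6) e) ⟩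
  64 * (x ^ (d * 6) * x ^ e)       ≡⟨ cong (λ z → 64 * (z * x ^ e)) (^-*-assoc x d 6) ⟨
  64 * ((x ^ d) ^ 6 * x ^ e)       ≡⟨ collect (x ^ d) (x ^ e) ⟩
  (2 * x ^ d) ^ 6 * x ^ e          ≤⟨ *-mono-≤ (^-monoˡ-≤ 6 (2*x^h≤[1+x]^h x d ≤-refl)) (^-monoˡ-≤ e (n≤1+n x)) ⟩
  (d ^ d) ^ 6 * d ^ e              ≡⟨ cong (_* d ^ e) (^-*-assoc d d 6) ⟩
  d ^ (d * 6) * d ^ e              ≡⟨ ^-distribˡ-+-* d (d * 6) e ⟨
  d ^ (d * 6 + e)                  ≡⟨ cong (d ^_) (m+[n∸m]≡n p) ⟩
  suc x ^ h                        ∎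
  where
  open ≤-Reasoning
  d = suc x
  e = h ∸ d * 6
  collect : ∀ a b → 64 * (a * (a * (a * (a * (a * (a * 1))))) * b)
    ≡ 2 * a * (2 * a * (2 * a * (2 * a * (2 * a * (2 * a * 1))))) * b
  collect = solve-∀

-- Divided by `R ^ H`: `H` random letters all miss `e` given rows with probability at most
-- `64^(-e)`. Rows are excluded one at a time; every ratio `(x / (x + 1))^H` gains 64 because
-- `x + 1 ≤ R`.
64^e*[R∸e]^H≤R^H : ∀ R H → R * 6 ≤ H → ∀ e → e ≤ R → 64 ^ e * (R ∸ e) ^ H ≤ R ^ H
64^e*[R∸e]^H≤R^H R H p zero    _ = ≤-reflexive (+-identityʳ _)
64^e*[R∸e]^H≤R^H R H p (suc e) q = begin
  64 * 64 ^ e * x ^ H        ≡⟨ shuffle 64 (64 ^ e) (x ^ H) ⟩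
  64 ^ e * (64 * x ^ H)      ≤⟨ *-monoʳ-≤ (64 ^ e) (64*x^h≤[1+x]^h x H (≤-trans (*-monoˡ-≤ 6 1+x≤R) p)) ⟩
  64 ^ e * suc x ^ H         ≡⟨ cong (λ z → 64 ^ e * z ^ H) (+-∸-assoc 1 q) ⟨
  64 ^ e * (R ∸ e) ^ H       ≤⟨ 64^e*[R∸e]^H≤R^H R H p e (<⇒≤ q) ⟩
  R ^ H                      ∎
  where
  open ≤-Reasoning
  x = R ∸ suc e
  1+x≤R : suc x ≤ R
  1+x≤R = ≤-trans (≤-reflexive (sym (+-∸-assoc 1 q))) (m∸n≤m R e)
  shuffle : ∀ a b c → a * b * c ≡ b * (a * c)
  shuffle = solve-∀

-- Common subsequences and avoided rows

module _ {R : ℕ} where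

  -- In the maximum, `lcs xs ys` stands for two searches that both advance in the same column, the
  -- other two terms for one of them advancing alone.
  lcs : List (Fin R) → List (Fin R) → ℕ
  lcs []       ys       = 0
  lcs (x ∷ xs) []       = 0
  lcs (x ∷ xs) (y ∷ ys) =
    if ⌊ x ≟ y ⌋ then suc (lcs xs ys) else lcs xs ys ⊔ (lcs xs (y ∷ ys) ⊔ lcs (x ∷ xs) ys)

  -- Indicators are numbers, so that conjunctions become products and can be averaged.
  differs : Fin R → Fin R → ℕ
  differs r x with x ≟ r
  ... | yes _ = 0
  ... | no  _ = 1

  avoid : List (Fin R) → Fin R → ℕ
  avoid []      x = 1
  avoid (r ∷ S) x = differs r x * avoid S x

  avoid-∉ : ∀ S {x} → x ∉ S → avoid S x ≡ 1
  avoid-∉ []      p = refl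
  avoid-∉ (r ∷ S) {x} p with x ≟ r
  ... | yes e = ⊥-elim (p (here e))
  ... | no  _ = trans (+-identityʳ _) (avoid-∉ S (λ q → p (there q)))

private
  differs-suc : ∀ {R} (r x : Fin R) → differs (suc r) (suc x) ≡ differs r x
  differs-suc r x with x ≟ r
  ... | yes _ = refl
  ... | no  _ = refl

∑-tabulate : ∀ {A : Set} {n} (g : Fin n → A) (f : A → ℕ) → ∑ (tabulate g) f ≡ ∑ (allFin n) (λ x → f (g x))
∑-tabulate {n = zero}  g f = refl
∑-tabulate {n = suc n} g f = cong (f (g zero) +_)
  (trans (∑-tabulate (λ x → g (suc x)) f) (sym (∑-tabulate suc (λ x → f (g x)))))

∑-split : ∀ {R} (r : Fin R) (f : Fin R → ℕ) → f r + ∑ (allFin R) (λ x → differs r x * f x) ≡ ∑ (allFin R) f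
∑-split {suc R} zero f = cong (f zero +_)
  (trans (∑-tabulate {n = R} Fin.suc (λ x → differs zero x * f x)) (trans (∑-cong (allFin R) (λ x → +-identityʳ _)) (sym (∑-tabulate Fin.suc f))))
∑-split {suc R} (suc r) f = begin
  f (suc r) + (f zero + 0 + ∑ (tabulate suc) (λ x → differs (suc r) x * f x))
    ≡⟨ cong (λ z → f (suc r) + (f zero + 0 + z)) (trans (∑-tabulate {n = R} Fin.suc (λ x → differs (suc r) x * f x)) (∑-cong (allFin R) (λ x → cong (_* f (suc x)) (differs-suc r x)))) ⟩
  f (suc r) + (f zero + 0 + ∑ (allFin R) (λ x → differs r x * f (suc x)))
    ≡⟨ shuffle (f (suc r)) (f zero) _ ⟩
  f zero + (f (suc r) + ∑ (allFin R) (λ x → differs r x * f (suc x)))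
    ≡⟨ cong (f zero +_) (trans (∑-split r (λ x → f (suc x))) (sym (∑-tabulate Fin.suc f))) ⟩
  f zero + ∑ (tabulate suc) f ∎
  where
  open ≡-Reasoning
  shuffle : ∀ a b c → a + (b + 0 + c) ≡ b + (a + c)
  shuffle = solve-∀

length-allFin : ∀ n → length (allFin n) ≡ n
length-allFin n = length-tabulate {n = n} (λ x → x)

∑-avoid : ∀ {R} {S : List (Fin R)} → Unique S → length S + ∑ (allFin R) (avoid S) ≡ R
∑-avoid {R} {[]} [] = trans (sym (length≡∑1 (allFin R))) (length-allFin R)
∑-avoid {R} {r ∷ S} u@(_ ∷ u′) = begin
  suc (length S) + ∑ (allFin R) (avoid (r ∷ S))              ≡⟨ +-suc (length S) _ ⟨
  length S + suc (∑ (allFin R) (avoid (r ∷ S)))              ≡⟨ cong (λ z → length S + (z + ∑ (allFin R) (avoid (r ∷ S)))) (avoid-∉ S (Unique.Unique[x∷xs]⇒x∉xs u)) ⟨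
  length S + (avoid S r + ∑ (allFin R) (avoid (r ∷ S)))      ≡⟨ cong (length S +_) (∑-split r (avoid S)) ⟩
  length S + ∑ (allFin R) (avoid S)                          ≡⟨ ∑-avoid u′ ⟩
  R ∎
  where open ≡-Reasoning

module Grid (R W H : ℕ) where

  -- A letter is a value of the large alphabet, split into its strip (`Fin R`) and its place within
  -- the strip (`Fin W`). Only the strip matters to the search; the second part keeps the alphabet
  -- large.
  Row Letter Column : Set
  Row    = Fin R
  Letter = Fin R × Fin W
  Column = Vec Letter H

  letters : List Letter
  letters = cartesianProduct (allFin R) (allFin W)

  columns : List Column
  columns = vecs letters H

  words : ∀ c → List (Vec Column c)
  words = vecs columns

  empty : ∀ {h} → Row → Vec Letter h → ℕ
  empty r = ∏ᵛ (λ a → differs r (proj₁ a))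

  empty-01 : ∀ {h} r (b : Vec Letter h) → empty r b ≡ 0 ⊎ empty r b ≡ 1
  empty-01 r []      = inj₂ refl
  empty-01 r (a ∷ b) with proj₁ a ≟ r
  ... | yes _ = inj₁ refl
  ... | no  _ rewrite +-identityʳ (empty r b) = empty-01 r b

  empty≡0⇒hit : ∀ {h} r (b : Vec Letter h) → empty r b ≡ 0 → ∃ λ i → proj₁ (lookup b i) ≡ r
  empty≡0⇒hit r (a ∷ b) e with proj₁ a ≟ r
  ... | yes p = zero , p
  ... | no  _ with empty≡0⇒hit r b (trans (sym (+-identityʳ _)) e)
  ...   | i , q = suc i , q

  -- A list holds the rows still to be hit by the greedy left-to-right search, in order.
  step : Column → List Row → List Row
  step b []      = []
  step b (r ∷ t) with empty r b
  ... | zero  = t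
  ... | suc _ = r ∷ t

  after : ∀ {c} → List Row → Vec Column c → List Row
  after t []      = t
  after t (b ∷ w) = after (step b t) w

  miss : List Row → Column → ℕ
  miss []      b = 0
  miss (r ∷ _) b = empty r b

  misses : ∀ {c} → List Row → Vec Column c → ℕ
  misses t []      = 0
  misses t (b ∷ w) = miss t b + misses (step b t) w

  joint : List Row → List Row → Column → ℕ
  joint []      _        b = 0
  joint (_ ∷ _) []       b = 0
  joint (r ∷ _) (r′ ∷ _) b = if ⌊ r ≟ r′ ⌋ then empty r b else 0

  jointMisses : ∀ {c} → List Row → List Row → Vec Column c → ℕ
  jointMisses t t′ []      = 0
  jointMisses t t′ (b ∷ w) = joint t t′ b + jointMisses (step b t) (step b t′) w

  -- Only the initial empty stretch is measured; `ShortRuns` bounds it from every starting column.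
  run : ∀ {c} → Row → Vec Column c → ℕ
  run r []      = 0
  run r (b ∷ w) with empty r b
  ... | zero  = 0
  ... | suc _ = suc (run r w)

  ShortRuns : ∀ {c} → ℕ → Vec Column c → Set
  ShortRuns ℓ []      = ⊤
  ShortRuns ℓ (b ∷ w) = (∀ r → run r (b ∷ w) ≤ ℓ) × ShortRuns ℓ w

  -- In each column an unfinished search either misses or advances, and it advances at most
  -- `length t` times.
  ¬finished⇒misses : ∀ {c} t (w : Vec Column c) → after t w ≢ [] → c ≤ misses t w + length t
  ¬finished⇒misses t       []      _ = z≤n
  ¬finished⇒misses []      (b ∷ w) p = ⊥-elim (p (after-[] w))
    where
    after-[] : ∀ {c} (w : Vec Column c) → after [] w ≡ []
    after-[] []      = refl
    after-[] (b ∷ w) = after-[] w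
  ¬finished⇒misses (r ∷ t) (b ∷ w) p with empty r b | empty-01 r b
  ... | zero  | _         = ≤-trans (s≤s (¬finished⇒misses t w p)) (≤-reflexive (sym (+-suc _ _)))
  ... | suc _ | inj₂ refl = s≤s (¬finished⇒misses (r ∷ t) w p)

  finished⇒hits : ∀ {c m} (t : Vec Row m) (w : Vec Column c) → after (toList t) w ≡ [] →
    Σ (Fin m → Fin c) λ x → (∀ i j → i Fin.< j → x i Fin.< x j) ×
      (∀ i → ∃ λ h → proj₁ (lookup (lookup w (x i)) h) ≡ lookup t i)
  finished⇒hits []      w       e = (λ ()) , (λ ()) , (λ ())
  finished⇒hits (r ∷ t) (b ∷ w) e with empty r b in eq
  ... | zero with finished⇒hits t w e
  ...   | x , mono , hit = x′ , mono′ , hit′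
    where
    x′ : Fin _ → Fin _
    x′ zero    = zero
    x′ (suc i) = suc (x i)
    mono′ : ∀ i j → i Fin.< j → x′ i Fin.< x′ j
    mono′ zero    (suc j) _ = s≤s z≤n
    mono′ (suc i) (suc j) p = s≤s (mono i j (s≤s⁻¹ p))
    hit′ : ∀ i → ∃ λ h → proj₁ (lookup (lookup (b ∷ w) (x′ i)) h) ≡ lookup (r ∷ t) i
    hit′ zero    = empty≡0⇒hit r b eq
    hit′ (suc i) = hit i
  finished⇒hits (r ∷ t) (b ∷ w) e | suc _ with finished⇒hits (r ∷ t) w e
  ... | x , mono , hit = (λ i → suc (x i)) , (λ i j p → s≤s (mono i j p)) , hit

  mutual
    -- The state in the middle of a common wait for `r`: the two searches share the rest of the
    -- current run and then advance in the same column.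
    jointMisses≤run+lcs : ∀ {c} ℓ r t t′ (w : Vec Column c) → ShortRuns ℓ w →
      jointMisses (r ∷ t) (r ∷ t′) w ≤ run r w + ℓ * lcs t t′
    jointMisses≤run+lcs ℓ r t t′ []      sr = z≤n
    jointMisses≤run+lcs ℓ r t t′ (b ∷ w) (_ , sr) with r ≟ r
    ... | no ¬e = ⊥-elim (¬e refl)
    ... | yes _ with empty r b | empty-01 r b
    ...   | zero  | _         = jointMisses≤lcs ℓ t t′ w sr
    ...   | suc _ | inj₂ refl = s≤s (jointMisses≤run+lcs ℓ r t t′ w sr)

    -- Cells are shared only while the heads agree, and then both searches move on together. The
    -- shared heads thus form a common subsequence, and each of them costs one run, at most `ℓ`.
    jointMisses≤lcs : ∀ {c} ℓ t t′ (w : Vec Column c) → ShortRuns ℓ w →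
      jointMisses t t′ w ≤ ℓ * lcs t t′
    jointMisses≤lcs ℓ t       t′       []      sr = z≤n
    jointMisses≤lcs ℓ []      t′       (b ∷ w) (_ , sr) = jointMisses≤lcs ℓ [] (step b t′) w sr
    jointMisses≤lcs ℓ (r ∷ t) []       (b ∷ w) (_ , sr) =
      ≤-trans (jointMisses≤lcs ℓ (step b (r ∷ t)) [] w sr) (≤-reflexive (cong (ℓ *_) (lcs-[] (step b (r ∷ t)))))
      where
      lcs-[] : ∀ t → lcs t [] ≡ 0
      lcs-[] []      = refl
      lcs-[] (_ ∷ _) = refl
    jointMisses≤lcs ℓ (r ∷ t) (r′ ∷ t′) (b ∷ w) sr with r ≟ r′
    ... | no ¬e = ≤-trans (jointMisses≤lcs ℓ (step b (r ∷ t)) (step b (r′ ∷ t′)) w (proj₂ sr)) (*-monoʳ-≤ ℓ lcs-step)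
      where
      -- With different heads nothing is shared in this column; each way of advancing is one branch
      -- of the maximum in `lcs`, or leaves both lists unchanged.
      lcs-step : lcs (step b (r ∷ t)) (step b (r′ ∷ t′)) ≤ lcs t t′ ⊔ (lcs t (r′ ∷ t′) ⊔ lcs (r ∷ t) t′)
      lcs-step with empty r b | empty r′ b
      ... | zero  | zero  = m≤m⊔n _ _
      ... | zero  | suc _ = ≤-trans (m≤m⊔n _ _) (m≤n⊔m (lcs t t′) _)
      ... | suc _ | zero  = ≤-trans (m≤n⊔m (lcs t (r′ ∷ t′)) _) (m≤n⊔m (lcs t t′) _)
      ... | suc _ | suc _ with r ≟ r′
      ...   | yes e = ⊥-elim (¬e e)
      ...   | no _  = ≤-refl
    ... | yes refl with empty r b | empty-01 r b | proj₁ sr r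
    ...   | zero  | _         | _ =
      ≤-trans (jointMisses≤lcs ℓ t t′ w (proj₂ sr)) (*-monoʳ-≤ ℓ (n≤1+n _))
    -- This miss together with the rest of the run is at most `ℓ`, charged to the matched pair of
    -- heads.
    ...   | suc _ | inj₂ refl | p =
      ≤-trans (s≤s (jointMisses≤run+lcs ℓ r t t′ w (proj₂ sr)))
              (≤-trans (+-monoˡ-≤ (ℓ * lcs t t′) p) (≤-reflexive (sym (*-suc ℓ _))))

  -- Repetitions are dropped so that a cell wanted by several searches is counted once.
  heads : List (List Row) → List Row
  heads []             = []
  heads ([] ∷ ts)      = heads ts
  heads ((r ∷ _) ∷ ts) = if ⌊ _∈?_ _≟_ r (heads ts) ⌋ then heads ts else r ∷ heads ts

  heads-unique : ∀ ts → Unique (heads ts)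
  heads-unique []             = []
  heads-unique ([] ∷ ts)      = heads-unique ts
  heads-unique ((r ∷ _) ∷ ts) with _∈?_ _≟_ r (heads ts)
  ... | yes _  = heads-unique ts
  ... | no  r∉ = All.¬Any⇒All¬ _ r∉ ∷ heads-unique ts

  length-heads : ∀ ts → length (heads ts) ≤ length ts
  length-heads []             = z≤n
  length-heads ([] ∷ ts)      = m≤n⇒m≤1+n (length-heads ts)
  length-heads ((r ∷ _) ∷ ts) with _∈?_ _≟_ r (heads ts)
  ... | yes _ = m≤n⇒m≤1+n (length-heads ts)
  ... | no  _ = s≤s (length-heads ts)

  distinctMisses : ∀ {c} → List (List Row) → Vec Column c → ℕ
  distinctMisses ts []      = 0
  distinctMisses ts (b ∷ w) = ∑ (heads ts) (λ r → empty r b) + distinctMisses (map (step b) ts) w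

  ∈heads⇒joint : ∀ b r t ts → r ∈ heads ts → empty r b ≤ ∑ ts (λ t′ → joint (r ∷ t) t′ b)
  ∈heads⇒joint b r t ([] ∷ ts)       p = ∈heads⇒joint b r t ts p
  ∈heads⇒joint b r t ((r′ ∷ _) ∷ ts) p with _∈?_ _≟_ r′ (heads ts) | p
  ... | yes _ | q       = ≤-trans (∈heads⇒joint b r t ts q) (m≤n+m _ _)
  ... | no  _ | there q = ≤-trans (∈heads⇒joint b r t ts q) (m≤n+m _ _)
  ... | no  _ | here e with r ≟ r′
  ...   | yes _ = m≤m+n _ _
  ...   | no ¬e = ⊥-elim (¬e e)

  -- If the new head is already wanted, its miss adds no new cell, but it is then a joint miss with
  -- some member of `ts`.
  miss-∷ : ∀ b t ts → miss t b + ∑ (heads ts) (λ r → empty r b)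
    ≤ ∑ (heads (t ∷ ts)) (λ r → empty r b) + ∑ ts (λ t′ → joint t t′ b)
  miss-∷ b []      ts = m≤m+n _ _
  miss-∷ b (r ∷ t) ts with _∈?_ _≟_ r (heads ts)
  ... | yes p = ≤-trans (+-monoˡ-≤ _ (∈heads⇒joint b r t ts p)) (≤-reflexive (+-comm (∑ ts (λ t′ → joint (r ∷ t) t′ b)) _))
  ... | no  _ = m≤m+n _ _

  misses-∷ : ∀ {c} t ts (w : Vec Column c) →
    misses t w + distinctMisses ts w ≤ distinctMisses (t ∷ ts) w + ∑ ts (λ t′ → jointMisses t t′ w)
  misses-∷ t ts []      = z≤n
  misses-∷ t ts (b ∷ w) = begin
    miss t b + misses (step b t) w + (∑ (heads ts) e + distinctMisses ts⁺ w)
      ≡⟨ swap (miss t b) _ _ _ ⟩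
    miss t b + ∑ (heads ts) e + (misses (step b t) w + distinctMisses ts⁺ w)
      ≤⟨ +-mono-≤ (miss-∷ b t ts) (misses-∷ (step b t) ts⁺ w) ⟩
    ∑ (heads (t ∷ ts)) e + ∑ ts (λ t′ → joint t t′ b)
      + (distinctMisses (step b t ∷ ts⁺) w + ∑ ts⁺ (λ t′ → jointMisses (step b t) t′ w))
      ≡⟨ swap (∑ (heads (t ∷ ts)) e) _ _ _ ⟩
    distinctMisses (t ∷ ts) (b ∷ w) + (∑ ts (λ t′ → joint t t′ b) + ∑ ts⁺ (λ t′ → jointMisses (step b t) t′ w))
      ≡⟨ cong (λ z → distinctMisses (t ∷ ts) (b ∷ w) + (∑ ts (λ t′ → joint t t′ b) + z)) (∑-map ts (step b) _) ⟩
    distinctMisses (t ∷ ts) (b ∷ w) + (∑ ts (λ t′ → joint t t′ b) + ∑ ts (λ t′ → jointMisses (step b t) (step b t′) w))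
      ≡⟨ cong (distinctMisses (t ∷ ts) (b ∷ w) +_) (∑-+ ts _ _) ⟨
    distinctMisses (t ∷ ts) (b ∷ w) + ∑ ts (λ t′ → jointMisses t t′ (b ∷ w)) ∎
    where
    open ≤-Reasoning
    ts⁺ = map (step b) ts
    e : Row → ℕ
    e r = empty r b
    swap : ∀ a b c d → a + b + (c + d) ≡ a + c + (b + d)
    swap = solve-∀

  -- Bonferroni's inequality: each search brings at least `d` misses, and each pair of searches
  -- shares at most `ℓ * l` of them.
  distinctMisses-lower : ∀ {c} ℓ l k d (w : Vec Column c) → ShortRuns ℓ w → c ≡ k + d → ∀ ts →
    AllPairs (λ t t′ → lcs t t′ ≤ l) ts →
    All (λ t → length t ≡ k × after t w ≢ []) ts →
    length ts * d ≤ distinctMisses ts w + length ts * (length ts * (ℓ * l))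
  distinctMisses-lower ℓ l k d w sr e [] _ _ = z≤n
  distinctMisses-lower {c} ℓ l k d w sr e (t ∷ ts) (q ∷ qs) ((len , unf) ∷ ps) = begin
    d + n * d
      ≤⟨ +-mono-≤ d≤misses (distinctMisses-lower ℓ l k d w sr e ts qs ps) ⟩
    misses t w + (distinctMisses ts w + n * (n * (ℓ * l)))
      ≡⟨ +-assoc (misses t w) _ _ ⟨
    misses t w + distinctMisses ts w + n * (n * (ℓ * l))
      ≤⟨ +-monoˡ-≤ _ (misses-∷ t ts w) ⟩
    distinctMisses (t ∷ ts) w + ∑ ts (λ t′ → jointMisses t t′ w) + n * (n * (ℓ * l))
      ≤⟨ +-monoˡ-≤ _ (+-monoʳ-≤ (distinctMisses (t ∷ ts) w) joint≤) ⟩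
    distinctMisses (t ∷ ts) w + n * (ℓ * l) + n * (n * (ℓ * l))
      -- Slack that completes `n + n * n` to `suc n * suc n`.
      ≤⟨ m≤m+n _ (n * (ℓ * l) + ℓ * l) ⟩
    distinctMisses (t ∷ ts) w + n * (ℓ * l) + n * (n * (ℓ * l)) + (n * (ℓ * l) + ℓ * l)
      ≡⟨ collect (distinctMisses (t ∷ ts) w) n (ℓ * l) ⟩
    distinctMisses (t ∷ ts) w + suc n * (suc n * (ℓ * l)) ∎
    where
    open ≤-Reasoning
    n = length ts
    collect : ∀ a n x → a + n * x + n * (n * x) + (n * x + x) ≡ a + suc n * (suc n * x)
    collect = solve-∀
    d≤misses : d ≤ misses t w
    d≤misses = +-cancelˡ-≤ k _ _ (≤-trans (≤-reflexive (sym e))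
      (≤-trans (¬finished⇒misses t w unf) (≤-reflexive (trans (cong (misses t w +_) len) (+-comm _ k)))))
    joint≤ : ∑ ts (λ t′ → jointMisses t t′ w) ≤ n * (ℓ * l)
    joint≤ = ≤-trans (∑-mono-∈ ts (λ {t′} p → ≤-trans (jointMisses≤lcs ℓ t t′ w sr) (*-monoʳ-≤ ℓ (All.lookup q p))))
                     (≤-reflexive (∑-const ts _))

  -- A given row is empty in a random column with probability at most 1/64.
  factor : List Row → Column → ℕ
  factor []      b = 1
  factor (r ∷ D) b = (1 + 64 * empty r b) * factor D b

  -- An exponential moment for the adaptive count `distinctMisses`. The rows charged in a column are
  -- decided by the earlier columns alone, so each factor can be averaged with the past fixed.
  weight : ∀ {c} → List (List Row) → Vec Column c → ℕ
  weight ts []      = 1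
  weight ts (b ∷ w) = factor (heads ts) b * weight (map (step b) ts) w

  64^empty≤factor : ∀ b D → 64 ^ ∑ D (λ r → empty r b) ≤ factor D b
  64^empty≤factor b []      = ≤-refl
  64^empty≤factor b (r ∷ D) =
    ≤-trans (≤-reflexive (^-distribˡ-+-* 64 (empty r b) _)) (*-mono-≤ one (64^empty≤factor b D))
    where
    one : 64 ^ empty r b ≤ 1 + 64 * empty r b
    one with empty r b | empty-01 r b
    ... | _ | inj₁ refl = ≤-refl
    ... | _ | inj₂ refl = n≤1+n 64

  64^distinctMisses≤weight : ∀ {c} ts (w : Vec Column c) → 64 ^ distinctMisses ts w ≤ weight ts w
  64^distinctMisses≤weight ts []      = ≤-refl
  64^distinctMisses≤weight ts (b ∷ w) =
    ≤-trans (≤-reflexive (^-distribˡ-+-* 64 (∑ (heads ts) (λ r → empty r b)) _))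
            (*-mono-≤ (64^empty≤factor b (heads ts)) (64^distinctMisses≤weight (map (step b) ts) w))

  -- Averages over random columns and words

  N : ℕ
  N = (R * W) ^ H

  length-letters : length letters ≡ R * W
  length-letters = trans (length-cartesianProductWith _,_ (allFin R) (allFin W))
                         (cong₂ _*_ (length-allFin R) (length-allFin W))

  length-columns : length columns ≡ N
  length-columns = trans (length-vecs letters H) (cong (_^ H) length-letters)

  length-words : ∀ c → length (words c) ≡ N ^ c
  length-words c = trans (length-vecs columns c) (cong (_^ c) length-columns)

  ∑-letters : (f : Row → ℕ) → ∑ letters (λ a → f (proj₁ a)) ≡ ∑ (allFin R) f * W
  ∑-letters f = begin
    ∑ letters (λ a → f (proj₁ a))                     ≡⟨ ∑-cartesianProductWith _,_ (allFin R) (allFin W) _ ⟩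
    ∑ (allFin R) (λ x → ∑ (allFin W) (λ _ → f x))     ≡⟨ ∑-cong (allFin R) (λ x → ∑-const (allFin W) (f x)) ⟩
    ∑ (allFin R) (λ x → length (allFin W) * f x)      ≡⟨ ∑-*ˡ (allFin R) (length (allFin W)) f ⟩
    length (allFin W) * ∑ (allFin R) f                ≡⟨ cong (_* ∑ (allFin R) f) (length-allFin W) ⟩
    W * ∑ (allFin R) f                                ≡⟨ *-comm W _ ⟩
    ∑ (allFin R) f * W                                ∎
    where open ≡-Reasoning

  avoidᵛ : List Row → Column → ℕ
  avoidᵛ S = ∏ᵛ (λ a → avoid S (proj₁ a))

  -- Summed over all rows and all starting columns, so that one upper bound on it limits every run.
  runWeight : ∀ {c} → Vec Column c → ℕ
  runWeight []      = 0
  runWeight (b ∷ w) = ∑ (allFin R) (λ r → 64 ^ run r (b ∷ w)) + runWeight w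

  runWeight<⇒ShortRuns : ∀ {c} ℓ (w : Vec Column c) → runWeight w < 64 ^ ℓ → ShortRuns ℓ w
  runWeight<⇒ShortRuns ℓ []      p = tt
  runWeight<⇒ShortRuns ℓ (b ∷ w) p = short , runWeight<⇒ShortRuns ℓ w (≤-<-trans (m≤n+m _ _) p)
    where
    short : ∀ r → run r (b ∷ w) ≤ ℓ
    short r = ≮⇒≥ (λ ℓ< → <⇒≱ p (≤-trans (^-monoʳ-≤ 64 (<⇒≤ ℓ<))
      (≤-trans (∑-∈ (λ r → 64 ^ run r (b ∷ w)) (∈-allFin r)) (m≤m+n _ _))))

  module _ (R*6≤H : R * 6 ≤ H) where

    -- The events that different rows are empty in one column are not independent, but the joint
    -- bound is as good as if they were: every letter must fall among the other `R ∸ e` rows.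
    ∑-avoidᵛ : ∀ {S} → Unique S → 64 ^ length S * ∑ columns (avoidᵛ S) ≤ N
    ∑-avoidᵛ {S} u = begin
      64 ^ e * ∑ columns (avoidᵛ S)                       ≡⟨ cong (64 ^ e *_) (∑-vecs-∏ᵛ letters _ H) ⟩
      64 ^ e * ∑ letters (λ a → avoid S (proj₁ a)) ^ H    ≡⟨ cong (λ z → 64 ^ e * z ^ H) (∑-letters (avoid S)) ⟩
      64 ^ e * (∑ (allFin R) (avoid S) * W) ^ H           ≡⟨ cong (λ z → 64 ^ e * (z * W) ^ H) size ⟩
      64 ^ e * ((R ∸ e) * W) ^ H                          ≡⟨ cong (64 ^ e *_) (^-distribʳ-* (R ∸ e) W H) ⟩
      64 ^ e * ((R ∸ e) ^ H * W ^ H)                      ≡⟨ *-assoc (64 ^ e) _ _ ⟨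
      64 ^ e * (R ∸ e) ^ H * W ^ H                        ≤⟨ *-monoˡ-≤ (W ^ H) (64^e*[R∸e]^H≤R^H R H R*6≤H e e≤R) ⟩
      R ^ H * W ^ H                                       ≡⟨ ^-distribʳ-* R W H ⟨
      N                                                   ∎
      where
      open ≤-Reasoning
      e = length S
      e≤R : e ≤ R
      e≤R = ≤-trans (m≤m+n e _) (≤-reflexive (∑-avoid u))
      size : ∑ (allFin R) (avoid S) ≡ R ∸ e
      size = trans (sym (m+n∸m≡n e _)) (cong (_∸ e) (∑-avoid u))

    -- Expanding the product over D into a sum over subsets, which are collected in S.
    ∑-avoidᵛ*factor : ∀ D S → Unique D → Unique S → All (_∉ S) D →
      64 ^ length S * ∑ columns (λ b → avoidᵛ S b * factor D b) ≤ 2 ^ length D * N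
    ∑-avoidᵛ*factor []      S _ uS _ = begin
      64 ^ length S * ∑ columns (λ b → avoidᵛ S b * 1)   ≡⟨ cong (64 ^ length S *_) (∑-cong columns (λ b → *-identityʳ _)) ⟩
      64 ^ length S * ∑ columns (avoidᵛ S)               ≤⟨ ∑-avoidᵛ uS ⟩
      N                                                  ≡⟨ +-identityʳ N ⟨
      1 * N                                              ∎
      where open ≤-Reasoning
    ∑-avoidᵛ*factor (r ∷ D) S (r∉D ∷ uD) uS (r∉S ∷ dj) = begin
      s * ∑ columns (λ b → avoidᵛ S b * ((1 + 64 * empty r b) * factor D b))
        ≡⟨ cong (s *_) (∑-cong columns (λ b → trans (expand (avoidᵛ S b) (empty r b) (factor D b))
             (cong (λ z → avoidᵛ S b * factor D b + 64 * (z * factor D b)) (sym (avoidᵛ-∷ b))))) ⟩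
      s * ∑ columns (λ b → avoidᵛ S b * factor D b + 64 * (avoidᵛ (r ∷ S) b * factor D b))
        ≡⟨ cong (s *_) (trans (∑-+ columns _ _) (cong (∑ columns (λ b → avoidᵛ S b * factor D b) +_) (∑-*ˡ columns 64 _))) ⟩
      s * (∑ columns (λ b → avoidᵛ S b * factor D b) + 64 * ∑ columns (λ b → avoidᵛ (r ∷ S) b * factor D b))
        ≡⟨ distrib s _ 64 _ ⟩
      s * ∑ columns (λ b → avoidᵛ S b * factor D b) + 64 * s * ∑ columns (λ b → avoidᵛ (r ∷ S) b * factor D b)
        ≤⟨ +-mono-≤ (∑-avoidᵛ*factor D S uD uS dj)
                    (∑-avoidᵛ*factor D (r ∷ S) uD (All.¬Any⇒All¬ _ r∉S ∷ uS) (All.zipWith fresh (r∉D , dj))) ⟩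
      2 ^ length D * N + 2 ^ length D * N
        ≡⟨ double (2 ^ length D) N ⟩
      2 ^ length (r ∷ D) * N ∎
      where
      open ≤-Reasoning
      s = 64 ^ length S
      avoidᵛ-∷ : ∀ b → avoidᵛ (r ∷ S) b ≡ empty r b * avoidᵛ S b
      avoidᵛ-∷ b = ∏ᵛ-* (λ a → differs r (proj₁ a)) (λ a → avoid S (proj₁ a)) b
      fresh : ∀ {x} → (r ≢ x) × (x ∉ S) → x ∉ r ∷ S
      fresh (r≢x , _)   (here e)  = r≢x (sym e)
      fresh (_   , x∉S) (there p) = x∉S p
      expand : ∀ a e f → a * ((1 + 64 * e) * f) ≡ a * f + 64 * (e * a * f)
      expand = solve-∀
      distrib : ∀ s a c b → s * (a + c * b) ≡ s * a + c * s * b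
      distrib = solve-∀
      double : ∀ a n → a * n + a * n ≡ 2 * a * n
      double = solve-∀

    -- Each of the `2 ^ length D` subsets in the expansion contributes at most `N`.
    ∑-factor : ∀ {D} → Unique D → ∑ columns (factor D) ≤ 2 ^ length D * N
    ∑-factor {D} u = ≤-trans (≤-reflexive (trans (∑-cong columns (λ b →
        sym (trans (cong (_* factor D b) (∏ᵛ-1 b)) (+-identityʳ _)))) (sym (+-identityʳ _))))
      (∑-avoidᵛ*factor D [] u [] (All.universal (λ _ ()) D))
      where
      ∏ᵛ-1 : ∀ {h} (b : Vec Letter h) → ∏ᵛ (λ _ → 1) b ≡ 1
      ∏ᵛ-1 []      = refl
      ∏ᵛ-1 (_ ∷ b) = trans (+-identityʳ _) (∏ᵛ-1 b)

    64*∑-empty : ∀ r → 64 * ∑ columns (empty r) ≤ N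
    64*∑-empty r = ≤-trans (≤-reflexive (cong (64 *_) (∑-cong columns go))) (∑-avoidᵛ {r ∷ []} ([] ∷ []))
      where
      go : ∀ {h} (b : Vec Letter h) → empty r b ≡ ∏ᵛ (λ a → avoid (r ∷ []) (proj₁ a)) b
      go []      = refl
      go (a ∷ b) = cong₂ _*_ (sym (*-identityʳ (differs r (proj₁ a)))) (go b)

    -- Once the first column `b` is fixed, what remains is the weight of `map (step b) ts`, a list
    -- of the same length. As the bound depends on `ts` only through its length, the induction
    -- hypothesis is uniform in `b`.
    ∑-weight : ∀ c {s} ts → length ts ≤ s → ∑ (words c) (weight ts) ≤ (2 ^ s * N) ^ c
    ∑-weight zero    {s} ts p = ≤-refl
    ∑-weight (suc c) {s} ts p = begin
      ∑ (words (suc c)) (weight ts)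
        ≡⟨ ∑-cartesianProductWith _∷_ columns (words c) _ ⟩
      ∑ columns (λ b → ∑ (words c) (λ w → factor (heads ts) b * weight (map (step b) ts) w))
        ≤⟨ ∑-mono columns (λ b → ≤-trans (≤-reflexive (∑-*ˡ (words c) (factor (heads ts) b) _))
             (*-monoʳ-≤ (factor (heads ts) b)
               (∑-weight c (map (step b) ts) (≤-trans (≤-reflexive (length-map (step b) ts)) p)))) ⟩
      ∑ columns (λ b → factor (heads ts) b * (2 ^ s * N) ^ c)
        ≡⟨ ∑-*ʳ columns _ (factor (heads ts)) ⟩
      ∑ columns (factor (heads ts)) * (2 ^ s * N) ^ c
        ≤⟨ *-monoˡ-≤ ((2 ^ s * N) ^ c) (≤-trans (∑-factor (heads-unique ts))
             (*-monoˡ-≤ N (^-monoʳ-≤ 2 (≤-trans (length-heads ts) p)))) ⟩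
      (2 ^ s * N) ^ suc c ∎
      where open ≤-Reasoning

    -- A run survives a column with probability at most 1/64, which the base 64 just cancels; so
    -- each column raises the mean by at most 1.
    ∑-64^run : ∀ c r → ∑ (words c) (λ w → 64 ^ run r w) ≤ suc c * N ^ c
    ∑-64^run zero    r = ≤-refl
    ∑-64^run (suc c) r = begin
      ∑ (words (suc c)) (λ w → 64 ^ run r w)
        ≡⟨ ∑-cartesianProductWith _∷_ columns (words c) _ ⟩
      ∑ columns (λ b → ∑ (words c) (λ w → 64 ^ run r (b ∷ w)))
        ≤⟨ ∑-mono columns (λ b → ∑-mono (words c) (λ w → pointwise b w)) ⟩
      ∑ columns (λ b → ∑ (words c) (λ w → 1 + 64 * empty r b * 64 ^ run r w))
        ≡⟨ ∑-cong columns (λ b → trans (∑-+ (words c) _ _)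
             (cong₂ _+_ (trans (sym (length≡∑1 (words c))) (length-words c)) (∑-*ˡ (words c) (64 * empty r b) _))) ⟩
      ∑ columns (λ b → N ^ c + 64 * empty r b * E)
        ≡⟨ trans (∑-+ columns _ _) (cong₂ _+_ (trans (∑-const columns _) (cong (_* N ^ c) length-columns))
             (trans (∑-*ʳ columns E _) (cong (_* E) (∑-*ˡ columns 64 (empty r))))) ⟩
      N ^ suc c + 64 * ∑ columns (empty r) * E
        ≤⟨ +-monoʳ-≤ (N ^ suc c) (*-mono-≤ (64*∑-empty r) (∑-64^run c r)) ⟩
      N ^ suc c + N * (suc c * N ^ c)
        ≡⟨ collect N (N ^ c) c ⟩
      suc (suc c) * N ^ suc c ∎
      where
      open ≤-Reasoning
      E = ∑ (words c) (λ w → 64 ^ run r w)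
      collect : ∀ n x c → n * x + n * (suc c * x) ≡ suc (suc c) * (n * x)
      collect = solve-∀
      pointwise : ∀ b (w : Vec Column c) → 64 ^ run r (b ∷ w) ≤ 1 + 64 * empty r b * 64 ^ run r w
      pointwise b w with empty r b | empty-01 r b
      ... | _ | inj₁ refl = s≤s z≤n
      ... | _ | inj₂ refl = n≤1+n _

    ∑-runWeight : ∀ c → ∑ (words c) runWeight ≤ c * (R * suc c) * N ^ c
    ∑-runWeight zero    = ≤-refl
    ∑-runWeight (suc c) = begin
      ∑ (words (suc c)) runWeight
        ≡⟨ ∑-cartesianProductWith _∷_ columns (words c) _ ⟩
      ∑ columns (λ b → ∑ (words c) (λ w → ∑ (allFin R) (λ r → 64 ^ run r (b ∷ w)) + runWeight w))
        ≡⟨ trans (∑-cong columns (λ b → ∑-+ (words c) _ _)) (∑-+ columns _ _) ⟩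
      ∑ columns (λ b → ∑ (words c) (λ w → ∑ (allFin R) (λ r → 64 ^ run r (b ∷ w))))
        + ∑ columns (λ _ → ∑ (words c) runWeight)
        ≡⟨ cong₂ _+_ (trans (sym (∑-cartesianProductWith _∷_ columns (words c) _)) (∑-swap (words (suc c)) (allFin R) _))
                     (trans (∑-const columns _) (cong (_* ∑ (words c) runWeight) length-columns)) ⟩
      ∑ (allFin R) (λ r → ∑ (words (suc c)) (λ w → 64 ^ run r w)) + N * ∑ (words c) runWeight
        ≤⟨ +-mono-≤ (≤-trans (∑-mono (allFin R) (∑-64^run (suc c))) (≤-reflexive
             (trans (∑-const (allFin R) _) (cong (_* (suc (suc c) * N ^ suc c)) (length-allFin R)))))
             (*-monoʳ-≤ N (∑-runWeight c)) ⟩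
      R * (suc (suc c) * N ^ suc c) + N * (c * (R * suc c) * N ^ c)
        -- Slack that completes `(c + 2) + c * (c + 1)` to `(c + 1) * (c + 2)`.
        ≤⟨ m≤m+n _ (c * R * (N * N ^ c)) ⟩
      R * (suc (suc c) * (N * N ^ c)) + N * (c * (R * suc c) * N ^ c) + c * R * (N * N ^ c)
        ≡⟨ collect R c N (N ^ c) ⟩
      suc c * (R * suc (suc c)) * N ^ suc c ∎
      where
      open ≤-Reasoning
      collect : ∀ r c n x → r * (suc (suc c) * (n * x)) + n * (c * (r * suc c) * x) + c * r * (n * x)
        ≡ suc c * (r * suc (suc c)) * (n * x)
      collect = solve-∀

-- Permutations and increasing sequences

private variable k l m n : ℕ

lookup-ext : {u v : Vec A n} → (∀ i → lookup u i ≡ lookup v i) → u ≡ v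
lookup-ext {u = u} {v} e = trans (sym (tabulate∘lookup u)) (trans (tabulate-cong e) (tabulate∘lookup v))

Vec-map-injective : {f : A → B} → (∀ {x y} → f x ≡ f y → x ≡ y) → {u v : Vec A n} → Vec.map f u ≡ Vec.map f v → u ≡ v
Vec-map-injective inj {[]}    {[]}    e = refl
Vec-map-injective inj {_ ∷ _} {_ ∷ _} e with ∷-injective e
... | p , q = cong₂ _∷_ (inj p) (Vec-map-injective inj q)

insertHead : Fin (suc n) → Vec (Fin n) n → Vec (Fin (suc n)) (suc n)
insertHead x π = x ∷ Vec.map (punchIn x) π

perms : ∀ n → List (Vec (Fin n) n)
perms zero    = [] ∷ []
perms (suc n) = cartesianProductWith insertHead (allFin (suc n)) (perms n)

length-perms : ∀ n → length (perms n) ≡ n !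
length-perms zero    = refl
length-perms (suc n) = trans (length-cartesianProductWith insertHead (allFin (suc n)) (perms n))
                             (cong₂ _*_ (length-allFin (suc n)) (length-perms n))

perms-unique : ∀ n → Unique (perms n)
perms-unique zero    = [] ∷ []
perms-unique (suc n) = Unique.cartesianProductWith⁺ insertHead injective (Unique.allFin⁺ (suc n)) (perms-unique n)
  where
  injective : ∀ {w x y z} → insertHead w y ≡ insertHead x z → w ≡ x × y ≡ z
  injective e with ∷-injective e
  ... | refl , q = refl , Vec-map-injective (punchIn-injective _ _ _) q

perms-sound : ∀ n {σ} → σ ∈ perms n → IsPerm σ
perms-sound (suc n) p with ∈-cartesianProductWith⁻ insertHead (allFin (suc n)) (perms n) p
... | x , π , _ , π∈ , refl = perm
  where
  perm : IsPerm (insertHead x π)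
  perm zero    zero    _ = refl
  perm zero    (suc j) e = ⊥-elim (punchInᵢ≢i x _ (trans (sym (lookup-map j (punchIn x) π)) (sym e)))
  perm (suc i) zero    e = ⊥-elim (punchInᵢ≢i x _ (trans (sym (lookup-map i (punchIn x) π)) e))
  perm (suc i) (suc j) e = cong suc (perms-sound n π∈ i j (punchIn-injective x _ _
    (trans (sym (lookup-map i (punchIn x) π)) (trans e (lookup-map j (punchIn x) π)))))

perms-complete : ∀ n {σ} → IsPerm σ → σ ∈ perms n
perms-complete zero    {[]}    _ = here refl
perms-complete (suc n) {x ∷ v} p = subst (_∈ perms (suc n)) (cong (x ∷_) (lookup-ext rebuild))
  (∈-cartesianProductWith⁺ insertHead (∈-allFin x) (perms-complete n {π} perm))
  where
  x≢ : ∀ i → x ≢ lookup v i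
  x≢ i e with p zero (suc i) e
  ... | ()
  π = Vec.tabulate (λ i → punchOut (x≢ i))
  rebuild : ∀ i → lookup (Vec.map (punchIn x) π) i ≡ lookup v i
  rebuild i = trans (lookup-map i (punchIn x) π)
    (trans (cong (punchIn x) (lookup∘tabulate _ i)) (punchIn-punchOut (x≢ i)))
  perm : IsPerm π
  perm i j e = Fin-suc-injective (p (suc i) (suc j) (punchOut-injective (x≢ i) (x≢ j)
    (trans (sym (lookup∘tabulate _ i)) (trans e (lookup∘tabulate _ j)))))

IsPerm⇒surjective : (σ : Vec (Fin n) n) → IsPerm σ → ∀ y → ∃ λ i → lookup σ i ≡ y
IsPerm⇒surjective {suc n} σ p y with any? (λ i → lookup σ i ≟ y)
... | yes q = q
-- Pigeonhole: if `y` is missed, `punchOut` at `y` injects `Fin (suc n)` into `Fin n`.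
... | no ¬q = ⊥-elim (1+n≰n (injective⇒≤ {f = λ i → punchOut (y≢ i)} (λ {i} {j} e → p i j (punchOut-injective (y≢ i) (y≢ j) e))))
  where
  y≢ : ∀ i → y ≢ lookup σ i
  y≢ i e = ¬q (i , sym e)

Increasing : Vec (Fin m) l → Set
Increasing v = ∀ i j → i Fin.< j → lookup v i Fin.< lookup v j

Increasing⇒injective : (v : Vec (Fin m) l) → Increasing v → ∀ {i j} → lookup v i ≡ lookup v j → i ≡ j
Increasing⇒injective v inc {i} {j} e with Fin-<-cmp i j
... | tri< i<j _ _ = ⊥-elim (Fin-<-irrefl e (inc i j i<j))
... | tri≈ _ i≡j _ = i≡j
... | tri> _ _ j<i = ⊥-elim (Fin-<-irrefl (sym e) (inc j i j<i))

Increasing-mono-≤ : (v : Vec (Fin m) l) → Increasing v → ∀ {i j} → toℕ i ≤ toℕ j → toℕ (lookup v i) ≤ toℕ (lookup v j)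
Increasing-mono-≤ v inc {i} {j} i≤j with m≤n⇒m<n∨m≡n i≤j
... | inj₁ i<j = <⇒≤ (inc i j i<j)
... | inj₂ i≡j = ≤-reflexive (cong (λ z → toℕ (lookup v z)) (toℕ-injective i≡j))

strictlyMono⇒inflationary : (f : Fin n → ℕ) → (∀ i j → i Fin.< j → f i < f j) →
  ∀ c → (∀ i → c ≤ f i) → ∀ i → c + toℕ i ≤ f i
strictlyMono⇒inflationary f mono c c≤ zero    = ≤-trans (≤-reflexive (+-identityʳ c)) (c≤ zero)
strictlyMono⇒inflationary f mono c c≤ (suc i) = ≤-trans (≤-reflexive (+-suc c (toℕ i)))
  (strictlyMono⇒inflationary (λ j → f (suc j)) (λ i j p → mono (suc i) (suc j) (s≤s p)) (suc c)
    (λ j → ≤-trans (s≤s (c≤ zero)) (mono zero (suc j) (s≤s z≤n))) i)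

Increasing-cancel-< : (v : Vec (Fin m) l) → Increasing v → ∀ {i j} → lookup v i Fin.< lookup v j → i Fin.< j
Increasing-cancel-< v inc {i} {j} p with Fin-<-cmp i j
... | tri< i<j _ _ = i<j
... | tri≈ _ i≡j _ = ⊥-elim (Fin-<-irrefl (cong (lookup v) i≡j) p)
... | tri> _ _ j<i = ⊥-elim (<-asym p (inc j i j<i))

-- Put `ρ = σ′ ∘ σ⁻¹`. Then `v = v′ ∘ ρ`, so `ρ` is strictly increasing, hence `i ≤ ρ i` and
-- `v′ i ≤ v′ (ρ i) = v i`.
rearrangement-≤ : {v v′ : Vec (Fin m) n} {σ σ′ : Vec (Fin n) n} →
  Increasing v → Increasing v′ → IsPerm σ →
  (∀ p → lookup v (lookup σ p) ≡ lookup v′ (lookup σ′ p)) →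
  ∀ i → toℕ (lookup v′ i) ≤ toℕ (lookup v i)
rearrangement-≤ {v = v} {v′} {σ} {σ′} inc inc′ perm e i =
  ≤-trans (Increasing-mono-≤ v′ inc′ (strictlyMono⇒inflationary (λ i → toℕ (ρ i)) ρ-mono 0 (λ _ → z≤n) i))
          (≤-reflexive (cong toℕ (sym (v≡v′∘ρ i))))
  where
  σ⁻¹ = λ i → proj₁ (IsPerm⇒surjective σ perm i)
  ρ = λ i → lookup σ′ (σ⁻¹ i)
  v≡v′∘ρ : ∀ i → lookup v i ≡ lookup v′ (ρ i)
  v≡v′∘ρ i = trans (cong (lookup v) (sym (proj₂ (IsPerm⇒surjective σ perm i)))) (e (σ⁻¹ i))
  ρ-mono : ∀ i j → i Fin.< j → ρ i Fin.< ρ j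
  ρ-mono i j i<j = Increasing-cancel-< v′ inc′ (subst₂ Fin._<_ (v≡v′∘ρ i) (v≡v′∘ρ j) (inc i j i<j))

-- Both `v` and `v′` are the sorted form of one sequence. This is the injectivity of
-- `(v , σ) ↦ v ∘ σ`, used for position lists as well as for words.
rearrangement-injective : {v v′ : Vec (Fin m) n} {σ σ′ : Vec (Fin n) n} →
  Increasing v → Increasing v′ → IsPerm σ → IsPerm σ′ →
  (∀ p → lookup v (lookup σ p) ≡ lookup v′ (lookup σ′ p)) → v ≡ v′ × σ ≡ σ′
rearrangement-injective {v = v} {v′} {σ} {σ′} inc inc′ perm perm′ e with lookup-ext {u = v} {v′} (λ i →
  toℕ-injective (≤-antisym (rearrangement-≤ {v = v′} {v} {σ = σ′} {σ} inc′ inc perm′ (λ p → sym (e p)) i)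
                           (rearrangement-≤ {v = v} {v′} {σ = σ} {σ′} inc inc′ perm e i)))
... | refl = refl , lookup-ext (λ p → Increasing⇒injective v inc (e p))

-- Enumerating and counting increasing sequences

raise : Vec (Fin m) l → Vec (Fin (suc m)) l
raise = Vec.map suc

zero∷ : Vec (Fin m) l → Vec (Fin (suc m)) (suc l)
zero∷ v = zero ∷ raise v

-- The `l`-element subsets of `Fin m`, by Pascal's recursion on whether `zero` belongs; the length
-- is a binomial coefficient.
increasing : ∀ l m → List (Vec (Fin m) l)
increasing zero    m       = [] ∷ []
increasing (suc l) zero    = []
increasing (suc l) (suc m) =
  map zero∷ (increasing l m) ++ map raise (increasing (suc l) m)

increasing-unique : ∀ l m → Unique (increasing l m)
increasing-unique zero    m       = [] ∷ []
increasing-unique (suc l) zero    = []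
increasing-unique (suc l) (suc m) = Unique.++⁺
  (Unique.map⁺ (λ e → Vec-map-injective Fin-suc-injective (proj₂ (∷-injective e))) (increasing-unique l m))
  (Unique.map⁺ (Vec-map-injective Fin-suc-injective) (increasing-unique (suc l) m))
  disjoint
  where
  disjoint : ∀ {v} → ¬ (v ∈ map zero∷ (increasing l m) × v ∈ map raise (increasing (suc l) m))
  disjoint (p , q) with ∈-map⁻ zero∷ p | ∈-map⁻ raise q
  ... | _ , _ , refl | (_ ∷ _) , _ , ()

Increasing-raise : (v : Vec (Fin m) l) → Increasing v → Increasing (raise v)
Increasing-raise v inc i j p =
  subst₂ Fin._<_ (sym (lookup-map i Fin.suc v)) (sym (lookup-map j Fin.suc v)) (s≤s (inc i j p))

increasing-sound : ∀ l m {v} → v ∈ increasing l m → Increasing v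
increasing-sound zero    m       _ ()
increasing-sound (suc l) (suc m) p with ∈-++⁻ (map zero∷ (increasing l m)) p
... | inj₁ q with ∈-map⁻ zero∷ q
...   | v , v∈ , refl = inc
  where
  inc : Increasing (zero∷ v)
  inc zero    (suc j) _ = subst (λ x → 0 < toℕ x) (sym (lookup-map j Fin.suc v)) (s≤s z≤n)
  inc (suc i) (suc j) p = Increasing-raise v (increasing-sound l m v∈) i j (s≤s⁻¹ p)
increasing-sound (suc l) (suc m) p | inj₂ q with ∈-map⁻ raise q
... | v , v∈ , refl = Increasing-raise v (increasing-sound (suc l) m v∈)

length-increasing-upper : ∀ l m → length (increasing l m) * l ! ≤ m ^ l
length-increasing-upper l m = begin
  length (increasing l m) * l !                          ≡⟨ cong (length (increasing l m) *_) (length-perms l) ⟨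
  length (increasing l m) * length (perms l)             ≡⟨ length-cartesianProductWith _,_ (increasing l m) (perms l) ⟨
  length (cartesianProduct (increasing l m) (perms l))   ≤⟨ injection⇒length≤ (λ (v , σ) → Vec.map (lookup v) σ)
      (Unique.cartesianProduct⁺ (increasing-unique l m) (perms-unique l)) injective (λ _ → ∈-vecs ∈-allFin _) ⟩
  length (vecs (allFin m) l)                             ≡⟨ length-vecs (allFin m) l ⟩
  length (allFin m) ^ l                                  ≡⟨ cong (_^ l) (length-allFin m) ⟩
  m ^ l ∎
  where
  open ≤-Reasoning
  injective : ∀ {x y} → x ∈ cartesianProduct (increasing l m) (perms l) → y ∈ cartesianProduct (increasing l m) (perms l) →
    Vec.map (lookup (proj₁ x)) (proj₂ x) ≡ Vec.map (lookup (proj₁ y)) (proj₂ y) → x ≡ y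
  injective {v , σ} {v′ , σ′} p q e with ∈-cartesianProduct⁻ (increasing l m) (perms l) p | ∈-cartesianProduct⁻ (increasing l m) (perms l) q
  ... | v∈ , σ∈ | v′∈ , σ′∈ with rearrangement-injective {v = v} {v′} {σ} {σ′} (increasing-sound l m v∈) (increasing-sound l m v′∈)
        (perms-sound l σ∈) (perms-sound l σ′∈)
        (λ p → trans (sym (lookup-map p (lookup v) σ)) (trans (cong (λ z → lookup z p) e) (lookup-map p (lookup v′) σ′)))
  ... | refl , refl = refl

-- The mean value bound for the increment of the power `suc n`, in the shape that Pascal's rule asks
-- for below.
[1+x]^[1+n]≤ : ∀ x n → suc x ^ suc n ≤ suc n * suc x ^ n + x ^ suc n
[1+x]^[1+n]≤ x zero    = ≤-refl
[1+x]^[1+n]≤ x (suc n) = begin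
  suc x * suc x ^ suc n                                       ≤⟨ *-monoʳ-≤ (suc x) ([1+x]^[1+n]≤ x n) ⟩
  suc x * (suc n * suc x ^ n + x ^ suc n)                     ≡⟨ expand x n (suc x ^ n) (x ^ suc n) ⟩
  x ^ suc n + (suc n * suc x ^ suc n + x ^ suc (suc n))       ≤⟨ +-monoˡ-≤ _ (^-monoˡ-≤ (suc n) (n≤1+n x)) ⟩
  suc x ^ suc n + (suc n * suc x ^ suc n + x ^ suc (suc n))   ≡⟨ +-assoc (suc x ^ suc n) _ _ ⟨
  suc (suc n) * suc x ^ suc n + x ^ suc (suc n)               ∎
  where
  open ≤-Reasoning
  expand : ∀ x n a b → suc x * (suc n * a + b) ≡ b + (suc n * (suc x * a) + x * b)
  expand = solve-∀

-- The right side is `(x + 1) ... (x + n)`; the induction goes through Pascal's rule instead of that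
-- formula.
length-increasing-lower : ∀ n x → x ^ n ≤ length (increasing n (x + n)) * n !
length-increasing-lower zero    x       = ≤-refl
length-increasing-lower (suc n) zero    = z≤n
length-increasing-lower (suc n) (suc x) = begin
  suc x ^ suc n                                     ≤⟨ [1+x]^[1+n]≤ x n ⟩
  suc n * suc x ^ n + x ^ suc n                     ≤⟨ +-mono-≤ (*-monoʳ-≤ (suc n) (length-increasing-lower n (suc x)))
                                                                (length-increasing-lower (suc n) x) ⟩
  suc n * (length (increasing n (suc x + n)) * n !) + b * (suc n * n !)
    ≡⟨ cong (λ z → suc n * (length (increasing n z) * n !) + b * (suc n * n !)) (+-suc x n) ⟨
  suc n * (a * n !) + b * (suc n * n !)             ≡⟨ collect n a b (n !) ⟩
  (a + b) * (suc n * n !)                           ≡⟨ cong (_* (suc n * n !)) (sym lengths) ⟩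
  length (increasing (suc n) (suc x + suc n)) * suc n ! ∎
  where
  open ≤-Reasoning
  a = length (increasing n (x + suc n))
  b = length (increasing (suc n) (x + suc n))
  lengths : length (increasing (suc n) (suc x + suc n)) ≡ a + b
  lengths = trans (length-++ (map zero∷ (increasing n (x + suc n))))
    (cong₂ _+_ (length-map zero∷ (increasing n (x + suc n))) (length-map raise (increasing (suc n) (x + suc n))))
  collect : ∀ n a b f → suc n * (a * f) + b * (suc n * f) ≡ (a + b) * (suc n * f)
  collect = solve-∀

-- Permutations that agree with a shift of themselves

module _ (A : Vec (Fin k) l) (inc : Increasing A) where

  reindex : Vec (Fin l) l → Fin k → Fin k
  reindex τ p with any? (λ i → lookup A i ≟ p)
  ... | yes (i , _) = lookup A (lookup τ i)
  ... | no  _       = p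

  reindex-∉ : ∀ τ {p} → ¬ (∃ λ i → lookup A i ≡ p) → reindex τ p ≡ p
  reindex-∉ τ {p} ∉A with any? (λ i → lookup A i ≟ p)
  ... | yes q = ⊥-elim (∉A q)
  ... | no  _ = refl

  reindex-∈ : ∀ τ i → reindex τ (lookup A i) ≡ lookup A (lookup τ i)
  reindex-∈ τ i with any? (λ j → lookup A j ≟ lookup A i)
  ... | yes (j , e) = cong (λ z → lookup A (lookup τ z)) (Increasing⇒injective A inc e)
  ... | no  ∉A      = ⊥-elim (∉A (i , refl))

  reindex-injective : ∀ {τ} → IsPerm τ → ∀ {p q} → reindex τ p ≡ reindex τ q → p ≡ q
  reindex-injective {τ} perm {p} {q} e with any? (λ i → lookup A i ≟ p) | any? (λ i → lookup A i ≟ q)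
  ... | yes (i , refl) | yes (j , refl) = cong (lookup A) (perm i j (Increasing⇒injective A inc e))
  ... | yes (i , _)    | no ∉A          = ⊥-elim (∉A (lookup τ i , e))
  ... | no ∉A          | yes (j , _)    = ⊥-elim (∉A (lookup τ j , sym e))
  ... | no _           | no _           = e

  module _ (B : Vec (Fin k) l) {Δ Δ′ : ℕ} (Δ<Δ′ : Δ < Δ′) where

    Matches : Vec (Fin k) k → Set
    Matches π = ∀ i → toℕ (lookup π (lookup A i)) + Δ ≡ toℕ (lookup π (lookup B i)) + Δ′

    -- The values on A are determined, in increasing order of value, by those elsewhere.
    Matches-determined : ∀ {π π′} → Matches π → Matches π′ →
      (∀ p → ¬ (∃ λ i → lookup A i ≡ p) → lookup π p ≡ lookup π′ p) →
      ∀ p → Acc _<_ (toℕ (lookup π p)) → lookup π p ≡ lookup π′ p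
    Matches-determined {π} {π′} M M′ out p (acc rec) with any? (λ i → lookup A i ≟ p)
    ... | no ∉A          = out p ∉A
    ... | yes (i , refl) = toℕ-injective (+-cancelʳ-≡ Δ _ _
      (trans (M i) (trans (cong (λ z → toℕ z + Δ′) (Matches-determined {π} {π′} M M′ out (lookup B i) (rec smaller))) (sym (M′ i)))))
      where
      smaller : toℕ (lookup π (lookup B i)) < toℕ (lookup π (lookup A i))
      smaller = +-cancelʳ-< Δ _ _ (<-≤-trans (+-monoʳ-< _ Δ<Δ′) (≤-reflexive (sym (M i))))

    -- Shuffling the values of `π` on the positions `A` by any `τ` gives `k`-permutations that are
    -- all different: off `A` the values of `π` are intact and determine `π`, after which `τ` can be
    -- read off.
    length-Matches : ∀ {xs} → Unique xs → (∀ {π} → π ∈ xs → IsPerm π × Matches π) → length xs * l ! ≤ k !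
    length-Matches {xs} u h = begin
      length xs * l !                            ≡⟨ cong (length xs *_) (length-perms l) ⟨
      length xs * length (perms l)               ≡⟨ length-cartesianProductWith _,_ xs (perms l) ⟨
      length (cartesianProduct xs (perms l))     ≤⟨ injection⇒length≤ twist (Unique.cartesianProduct⁺ u (perms-unique l)) injective twist-∈ ⟩
      length (perms k)                           ≡⟨ length-perms k ⟩
      k !                                        ∎
      where
      open ≤-Reasoning
      twist : Vec (Fin k) k × Vec (Fin l) l → Vec (Fin k) k
      twist (π , τ) = Vec.tabulate (λ p → lookup π (reindex τ p))
      twist-∈ : ∀ {x} → x ∈ cartesianProduct xs (perms l) → twist x ∈ perms k
      twist-∈ {π , τ} x∈ with ∈-cartesianProduct⁻ xs (perms l) x∈
      ... | π∈ , τ∈ = perms-complete k (λ i j e → reindex-injective (perms-sound l τ∈)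
        (proj₁ (h π∈) _ _ (trans (sym (lookup∘tabulate _ i)) (trans e (lookup∘tabulate _ j)))))
      injective : ∀ {x y} → x ∈ cartesianProduct xs (perms l) → y ∈ cartesianProduct xs (perms l) → twist x ≡ twist y → x ≡ y
      injective {π , τ} {π′ , τ′} x∈ y∈ e with ∈-cartesianProduct⁻ xs (perms l) x∈ | ∈-cartesianProduct⁻ xs (perms l) y∈
      ... | π∈ , τ∈ | π′∈ , τ′∈ = cong₂ _,_ π≡π′ τ≡τ′
        where
        pointwise : ∀ p → lookup π (reindex τ p) ≡ lookup π′ (reindex τ′ p)
        pointwise p = trans (sym (lookup∘tabulate _ p)) (trans (cong (λ z → lookup z p) e) (lookup∘tabulate _ p))
        π≡π′ : π ≡ π′
        π≡π′ = lookup-ext (λ p → Matches-determined {π} {π′} (proj₂ (h π∈)) (proj₂ (h π′∈))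
          (λ p ∉A → trans (cong (lookup π) (sym (reindex-∉ τ ∉A))) (trans (pointwise p) (cong (lookup π′) (reindex-∉ τ′ ∉A))))
          p (<-wellFounded _))
        τ≡τ′ : τ ≡ τ′
        τ≡τ′ = lookup-ext (λ i → Increasing⇒injective A inc (proj₁ (h π∈) _ _
          (trans (cong (lookup π) (sym (reindex-∈ τ i))) (trans (pointwise (lookup A i))
            (trans (cong (lookup π′) (reindex-∈ τ′ i)) (cong (λ z → lookup z (lookup A (lookup τ′ i))) (sym π≡π′)))))))

-- Exactly `l` positions are extracted from a possibly longer common subsequence, so that the union
-- bound runs over position lists of one length.
lcs⇒common : ∀ {R} l (u : Vec (Fin R) m) (v : Vec (Fin R) n) → l ≤ lcs (toList u) (toList v) →
  ∃₂ λ A B → A ∈ increasing l m × B ∈ increasing l n × (∀ i → lookup u (lookup A i) ≡ lookup v (lookup B i))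
lcs⇒common zero    u       v       p = [] , [] , here refl , here refl , (λ ())
lcs⇒common (suc l) (x ∷ u) (y ∷ v) p with x ≟ y
... | yes refl with lcs⇒common l u v (s≤s⁻¹ p)
...   | A , B , A∈ , B∈ , eq = zero∷ A , zero∷ B , ∈-++⁺ˡ (∈-map⁺ zero∷ A∈) , ∈-++⁺ˡ (∈-map⁺ zero∷ B∈) , eq′
  where
  eq′ : ∀ i → lookup (x ∷ u) (lookup (zero∷ A) i) ≡ lookup (x ∷ v) (lookup (zero∷ B) i)
  eq′ zero    = refl
  eq′ (suc i) = trans (cong (lookup (x ∷ u)) (lookup-map i Fin.suc A)) (trans (eq i) (cong (lookup (x ∷ v)) (sym (lookup-map i Fin.suc B))))
lcs⇒common {m = suc m} {n = suc n} (suc l) (x ∷ u) (y ∷ v) p | no _ with ⊔-sel (lcs (toList u) (toList v)) (lcs (toList u) (y ∷ toList v) ⊔ lcs (x ∷ toList u) (toList v))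
... | inj₁ e with lcs⇒common (suc l) u v (≤-trans p (≤-reflexive e))
...   | A , B , A∈ , B∈ , eq = raise A , raise B
  , ∈-++⁺ʳ (map zero∷ (increasing l m)) (∈-map⁺ raise A∈) , ∈-++⁺ʳ (map zero∷ (increasing l n)) (∈-map⁺ raise B∈)
  , λ i → trans (cong (lookup (x ∷ u)) (lookup-map i Fin.suc A)) (trans (eq i) (cong (lookup (y ∷ v)) (sym (lookup-map i Fin.suc B))))
lcs⇒common {m = suc m} {n = suc n} (suc l) (x ∷ u) (y ∷ v) p | no _ | inj₂ e with ⊔-sel (lcs (toList u) (y ∷ toList v)) (lcs (x ∷ toList u) (toList v))
... | inj₁ e′ with lcs⇒common (suc l) u (y ∷ v) (≤-trans p (≤-reflexive (trans e e′)))
...   | A , B , A∈ , B∈ , eq = raise A , B , ∈-++⁺ʳ (map zero∷ (increasing l m)) (∈-map⁺ raise A∈) , B∈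
  , λ i → trans (cong (lookup (x ∷ u)) (lookup-map i Fin.suc A)) (eq i)
lcs⇒common {m = suc m} {n = suc n} (suc l) (x ∷ u) (y ∷ v) p | no _ | inj₂ e | inj₂ e′ with lcs⇒common (suc l) (x ∷ u) v (≤-trans p (≤-reflexive (trans e e′)))
... | A , B , A∈ , B∈ , eq = A , raise B , A∈ , ∈-++⁺ʳ (map zero∷ (increasing l n)) (∈-map⁺ raise B∈)
  , λ i → trans (eq i) (cong (lookup (y ∷ v)) (sym (lookup-map i Fin.suc B)))

-- Quasirandom patterns

module _ {k s : ℕ} where

  shift : Fin s → Fin k → Fin (k + s)
  shift Δ x = fromℕ< (+-mono-<-≤ (toℕ<n x) (<⇒≤ (toℕ<n Δ)))

  toℕ-shift : ∀ Δ x → toℕ (shift Δ x) ≡ toℕ x + toℕ Δ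
  toℕ-shift Δ x = toℕ-fromℕ< _

  shift-mono-< : ∀ Δ {x y} → x Fin.< y → shift Δ x Fin.< shift Δ y
  shift-mono-< Δ {x} {y} p = subst₂ _<_ (sym (toℕ-shift Δ x)) (sym (toℕ-shift Δ y)) (+-monoˡ-< (toℕ Δ) p)

  target : Vec (Fin k) k → Fin s → Vec (Fin (k + s)) k
  target π Δ = Vec.map (shift Δ) π

  -- A common subsequence of two targets is a pair of increasing position lists `a`, `b` with
  -- `π(a_i) + Δ = π(b_i) + Δ′`. So the condition limits how far `π` agrees with a vertical shift of
  -- itself.
  Quasirandom : ℕ → Vec (Fin k) k → Set
  Quasirandom l π = ∀ Δ Δ′ → Δ Fin.< Δ′ → lcs (toList (target π Δ)) (toList (target π Δ′)) < l

  quasirandom? : ∀ l π → Dec (Quasirandom l π)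
  quasirandom? l π = all? (λ Δ → all? (λ Δ′ → (Δ Fin<? Δ′) →-dec (_ <? l)))

  ¬Quasirandom⇒long : ∀ l π → ¬ Quasirandom l π →
    ∃₂ λ Δ Δ′ → Δ Fin.< Δ′ × l ≤ lcs (toList (target π Δ)) (toList (target π Δ′))
  ¬Quasirandom⇒long l π ¬q with ¬∀⟶∃¬ s _ (λ Δ → all? (λ Δ′ → (Δ Fin<? Δ′) →-dec (_ <? l))) ¬q
  ... | Δ , ¬q′ with ¬∀⟶∃¬ s _ (λ Δ′ → (Δ Fin<? Δ′) →-dec (_ <? l)) ¬q′
  ...   | Δ′ , ¬q″ with Δ Fin<? Δ′
  ...     | yes p = Δ , Δ′ , p , ≮⇒≥ (λ q → ¬q″ (λ _ → q))
  ...     | no ¬p = ⊥-elim (¬q″ (λ p → ⊥-elim (¬p p)))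

  nonQuasirandom : ℕ → List (Vec (Fin k) k)
  nonQuasirandom l = filter (λ π → ¬? (quasirandom? l π)) (perms k)

  -- Union bound over `Δ`, `Δ′`, `A`, `B`. One factor `l !` comes from `length-Matches`, the other
  -- two from bounding the numbers of choices of `A` and of `B` by `k ^ l / l !`.
  length-nonQuasirandom : ∀ l → length (nonQuasirandom l) * (l ! * l ! * l !) ≤ s * s * (k ^ l * k ^ l) * k !
  length-nonQuasirandom l = begin
    length (nonQuasirandom l) * (f * f * f)
      ≤⟨ *-monoˡ-≤ (f * f * f) (union-bound witnesses? (nonQuasirandom l) witnesses cover) ⟩
    ∑ witnesses count * (f * f * f)
      ≡⟨ shuffle (∑ witnesses count) f ⟩
    ∑ witnesses count * f * (f * f)
      ≡⟨ cong (_* (f * f)) (∑-*ʳ witnesses f count) ⟨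
    ∑ witnesses (λ y → count y * f) * (f * f)
      ≤⟨ *-monoˡ-≤ (f * f) (∑-mono-∈ witnesses count*f≤) ⟩
    ∑ witnesses (λ _ → k !) * (f * f)
      ≡⟨ cong (_* (f * f)) (trans (∑-const witnesses (k !)) (cong (_* k !) length-witnesses)) ⟩
    s * s * (a * a) * k ! * (f * f)
      ≡⟨ regroup s a (k !) f ⟩
    s * s * ((a * f) * (a * f)) * k !
      ≤⟨ *-monoˡ-≤ (k !) (*-monoʳ-≤ (s * s) (*-mono-≤ (length-increasing-upper l k) (length-increasing-upper l k))) ⟩
    s * s * (k ^ l * k ^ l) * k ! ∎
    where
    open ≤-Reasoning
    f = l !
    a = length (increasing l k)
    shifts = cartesianProduct (allFin s) (allFin s)
    positions = cartesianProduct (increasing l k) (increasing l k)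
    Witness = (Fin s × Fin s) × (Vec (Fin k) l × Vec (Fin k) l)
    witnesses : List Witness
    witnesses = cartesianProduct shifts positions
    Witnesses : Vec (Fin k) k → Witness → Set
    Witnesses π ((Δ , Δ′) , (A , B)) = Δ Fin.< Δ′ ×
      (∀ i → toℕ (lookup π (lookup A i)) + toℕ Δ ≡ toℕ (lookup π (lookup B i)) + toℕ Δ′)
    witnesses? : ∀ π y → Dec (Witnesses π y)
    witnesses? π ((Δ , Δ′) , (A , B)) = (Δ Fin<? Δ′) ×-dec all? (λ i → _ ≟ℕ _)
    count : Witness → ℕ
    count y = length (filter (λ π → witnesses? π y) (nonQuasirandom l))
    length-witnesses : length witnesses ≡ s * s * (a * a)
    length-witnesses = trans (length-cartesianProductWith _,_ shifts positions) (cong₂ _*_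
      (trans (length-cartesianProductWith _,_ (allFin s) (allFin s)) (cong₂ _*_ (length-allFin s) (length-allFin s)))
      (length-cartesianProductWith _,_ (increasing l k) (increasing l k)))
    cover : ∀ {π} → π ∈ nonQuasirandom l → ∃ λ y → y ∈ witnesses × Witnesses π y
    cover {π} π∈ with ¬Quasirandom⇒long l π (proj₂ (∈-filter⁻ (λ π → ¬? (quasirandom? l π)) {xs = perms k} π∈))
    ... | Δ , Δ′ , Δ<Δ′ , long with lcs⇒common l (target π Δ) (target π Δ′) long
    ...   | A , B , A∈ , B∈ , eq = ((Δ , Δ′) , (A , B))
      , ∈-cartesianProduct⁺ (∈-cartesianProduct⁺ (∈-allFin Δ) (∈-allFin Δ′)) (∈-cartesianProduct⁺ A∈ B∈)
      , Δ<Δ′ , λ i → trans (value Δ (lookup A i)) (trans (cong toℕ (eq i)) (sym (value Δ′ (lookup B i))))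
      where
      value : ∀ Δ p → toℕ (lookup π p) + toℕ Δ ≡ toℕ (lookup (target π Δ) p)
      value Δ p = sym (trans (cong toℕ (lookup-map p (shift Δ) π)) (toℕ-shift Δ _))
    count*f≤ : ∀ {y} → y ∈ witnesses → count y * f ≤ k !
    count*f≤ {y@((Δ , Δ′) , (A , B))} y∈ = bound (Δ Fin<? Δ′)
      where
      A∈ : A ∈ increasing l k
      A∈ = proj₁ (∈-cartesianProduct⁻ (increasing l k) (increasing l k) (proj₂ (∈-cartesianProduct⁻ shifts positions y∈)))
      bound : Dec (Δ Fin.< Δ′) → count y * f ≤ k !
      bound (no ¬p) = ≤-trans (≤-reflexive (cong (λ xs → length xs * f)
        (filter-none (λ π → witnesses? π y) {nonQuasirandom l} (All.universal (λ _ q → ¬p (proj₁ q)) _)))) z≤n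
      bound (yes p) = length-Matches A (increasing-sound l k A∈) B p
        (Unique.filter⁺ (λ π → witnesses? π y) (Unique.filter⁺ (λ π → ¬? (quasirandom? l π)) (perms-unique k)))
        (λ π∈ → let π∈′ , w = ∈-filter⁻ (λ π → witnesses? π y) {xs = nonQuasirandom l} π∈
                in perms-sound k (proj₁ (∈-filter⁻ (λ π → ¬? (quasirandom? l π)) {xs = perms k} π∈′)) , proj₂ w)
    shuffle : ∀ c f → c * (f * f * f) ≡ c * f * (f * f)
    shuffle = solve-∀
    regroup : ∀ s a g f → s * s * (a * a) * g * (f * f) ≡ s * s * ((a * f) * (a * f)) * g
    regroup = solve-∀

-- From grid words to permutations

≡[]? : {A : Set} (xs : List A) → Dec (xs ≡ [])
≡[]? []      = yes refl
≡[]? (_ ∷ _) = no λ ()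

-- Bernoulli's `(1 - d/M)^j ≥ 1 - j d/M` for `M = y + d`, multiplied by `M ^ suc j`.
[y+d]^j-bound : ∀ y d j → (y + d) * (y + d) ^ j ≤ (y + d) * y ^ j + j * d * (y + d) ^ j
[y+d]^j-bound y d zero    = m≤m+n _ _
[y+d]^j-bound y d (suc j) = begin
  M * (M * M ^ j)                                    ≤⟨ *-monoʳ-≤ M ([y+d]^j-bound y d j) ⟩
  M * (M * y ^ j + j * d * M ^ j)                    ≡⟨ expand y d j (y ^ j) (M ^ j) ⟩
  M * (y * y ^ j) + j * d * (M * M ^ j) + d * (M * y ^ j)
    ≤⟨ +-monoʳ-≤ _ (*-monoʳ-≤ d (*-monoʳ-≤ M (^-monoˡ-≤ j (m≤m+n y d)))) ⟩
  M * (y * y ^ j) + j * d * (M * M ^ j) + d * (M * M ^ j)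
    ≡⟨ collect (M * (y * y ^ j)) j d (M * M ^ j) ⟩
  M * y ^ suc j + suc j * d * M ^ suc j ∎
  where
  open ≤-Reasoning
  M = y + d
  expand : ∀ y d j a b → (y + d) * ((y + d) * a + j * d * b) ≡ (y + d) * (y * a) + j * d * ((y + d) * b) + d * ((y + d) * a)
  expand = solve-∀
  collect : ∀ a j d b → a + j * d * b + d * b ≡ a + suc j * d * b
  collect = solve-∀

[y+d]^j≤2*y^j : ∀ y d j → 0 < y + d → 2 * (j * d) ≤ y + d → (y + d) ^ j ≤ 2 * y ^ j
[y+d]^j≤2*y^j y d j pos p = *-cancelˡ-≤ M {{>-nonZero pos}} (+-cancelʳ-≤ (M * M ^ j) _ _ (begin
  M * M ^ j + M * M ^ j                            ≡⟨ double (M * M ^ j) ⟩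
  2 * (M * M ^ j)                                  ≤⟨ *-monoʳ-≤ 2 ([y+d]^j-bound y d j) ⟩
  2 * (M * y ^ j + j * d * M ^ j)                  ≡⟨ expand M (y ^ j) (j * d) (M ^ j) ⟩
  M * (2 * y ^ j) + 2 * (j * d) * M ^ j            ≤⟨ +-monoʳ-≤ _ (*-monoˡ-≤ (M ^ j) p) ⟩
  M * (2 * y ^ j) + M * M ^ j                      ∎))
  where
  open ≤-Reasoning
  M = y + d
  double : ∀ a → a + a ≡ 2 * a
  double = solve-∀
  expand : ∀ m a c b → 2 * (m * a + c * b) ≡ m * (2 * a) + 2 * c * b
  expand = solve-∀

-- At least half of the words of length `n` have distinct letters, once the alphabet has `2 n^2` of
-- them: Bernoulli with `j = d = n`.
M^n≤2*increasing*n! : ∀ n M → 0 < M → n ≤ M → 2 * (n * n) ≤ M → M ^ n ≤ 2 * (length (increasing n M) * n !)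
M^n≤2*increasing*n! n M pos n≤M p = subst (λ z → z ^ n ≤ 2 * (length (increasing n z) * n !)) (m∸n+n≡m n≤M)
  (≤-trans ([y+d]^j≤2*y^j (M ∸ n) n n (subst (0 <_) (sym (m∸n+n≡m n≤M)) pos) (subst (2 * (n * n) ≤_) (sym (m∸n+n≡m n≤M)) p))
           (*-monoʳ-≤ 2 (length-increasing-lower n (M ∸ n))))

-- The grid word of a permutation

module Embedding (k s W C H n : ℕ) (C≡k+k : C ≡ k + k) (C*H≡n : C * H ≡ n) where

  R : ℕ
  R = k + s

  open Grid R W H public

  position : Fin C → Fin H → Fin n
  position c h = cast C*H≡n (combine c h)

  position-mono-< : ∀ {c c′} h h′ → c Fin.< c′ → position c h Fin.< position c′ h′
  position-mono-< h h′ p = subst₂ _<_ (sym (toℕ-cast C*H≡n _)) (sym (toℕ-cast C*H≡n _)) (combine-monoˡ-< h h′ p)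

  position-surjective : ∀ p → ∃₂ λ c h → position c h ≡ p
  position-surjective p with combine-surjective {C} {H} (cast (sym C*H≡n) p)
  ... | c , h , e = c , h , trans (cong (cast C*H≡n) e) (cast-involutive C*H≡n (sym C*H≡n) p)

  word : Vec (Fin (R * W)) n → Vec (Fin n) n → Vec Column C
  word v σ = Vec.tabulate λ c → Vec.tabulate λ h → remQuot {R} W (lookup v (lookup σ (position c h)))

  lookup-word : ∀ v σ c h → lookup (lookup (word v σ) c) h ≡ remQuot {R} W (lookup v (lookup σ (position c h)))
  lookup-word v σ c h = trans (cong (λ b → lookup b h) (lookup∘tabulate _ c)) (lookup∘tabulate _ h)

  word-injective : ∀ {v v′ σ σ′} → Increasing v → Increasing v′ → IsPerm σ → IsPerm σ′ →
    word v σ ≡ word v′ σ′ → v ≡ v′ × σ ≡ σ′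
  word-injective {v} {v′} {σ} {σ′} inc inc′ perm perm′ e = rearrangement-injective inc inc′ perm perm′ letter
    where
    letter : ∀ p → lookup v (lookup σ p) ≡ lookup v′ (lookup σ′ p)
    letter p with position-surjective p
    ... | c , h , refl = trans (sym (combine-remQuot {R} W _)) (trans (cong (uncurry combine)
      (trans (sym (lookup-word v σ c h)) (trans (cong (λ w → lookup (lookup w c) h) e) (lookup-word v′ σ′ c h))))
      (combine-remQuot {R} W _))

  row-<⇒< : ∀ {x y : Fin (R * W)} → proj₁ (remQuot {R} W x) Fin.< proj₁ (remQuot {R} W y) → x Fin.< y
  row-<⇒< {x} {y} p = subst₂ Fin._<_ (combine-remQuot {R} W x) (combine-remQuot {R} W y)
    (combine-monoˡ-< (proj₂ (remQuot {R} W x)) (proj₂ (remQuot {R} W y)) p)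

  -- Different values of `π` lie in different strips, in the same order, and an increasing `v` does
  -- not change the relative order of `σ`; so the hits form a copy of `π`.
  finished⇒Embeds : ∀ {v σ π} → Increasing v → IsPerm π → (Δ : Fin s) →
    after (toList (target π Δ)) (word v σ) ≡ [] → Contains σ π
  finished⇒Embeds {v} {σ} {π} inc perm Δ fin with finished⇒hits (target π Δ) (word v σ) fin
  ... | c , c-mono , hit = x , (λ i j p → position-mono-< _ _ (c-mono i j p)) , (λ i j → mk⇔ (to i j) (from i j))
    where
    x : Fin k → Fin n
    x i = position (c i) (proj₁ (hit i))
    row : ∀ i → proj₁ (remQuot {R} W (lookup v (lookup σ (x i)))) ≡ shift Δ (lookup π i)
    row i = trans (cong proj₁ (sym (lookup-word v σ (c i) (proj₁ (hit i)))))
                  (trans (proj₂ (hit i)) (lookup-map i (shift Δ) π))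
    from : ∀ i j → lookup π i Fin.< lookup π j → lookup σ (x i) Fin.< lookup σ (x j)
    from i j p = Increasing-cancel-< v inc
      (row-<⇒< (subst₂ Fin._<_ (sym (row i)) (sym (row j)) (shift-mono-< Δ p)))
    to : ∀ i j → lookup σ (x i) Fin.< lookup σ (x j) → lookup π i Fin.< lookup π j
    to i j p with Fin-<-cmp (lookup π i) (lookup π j)
    ... | tri< q _ _ = q
    ... | tri≈ _ q _ = ⊥-elim (Fin-<-irrefl (cong (λ z → lookup σ (x z)) (perm i j q)) p)
    ... | tri> _ _ q = ⊥-elim (<-asym p (from j i q))

  targets : Vec (Fin k) k → List (List Row)
  targets π = tabulate (λ Δ → toList (target π Δ))

  -- Counting bad permutations

  module _ (ℓ U : ℕ) where

    -- Long runs and large weights, scaled to the common threshold `64 ^ ℓ * 64 ^ U`, so that one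
    -- application of Markov's inequality excludes both.
    score : List (Vec (Fin k) k) → Vec Column C → ℕ
    score Q w = runWeight w * 64 ^ U + 64 ^ ℓ * ∑ Q (λ π → weight (targets π) w)

    Good : List (Vec (Fin k) k) → Vec Column C → Set
    Good Q w = score Q w < 64 ^ ℓ * 64 ^ U

    -- If every search failed, the distinct misses would number at least `s * k` less the overlaps
    -- `s * (s * (ℓ * l))`, hence at least `U`, and the weight would reach `64 ^ U`.
    Good⇒finished : ∀ {l} → s * (s * (ℓ * l)) + U ≤ s * k → ∀ {Q w π} → Good Q w → π ∈ Q → Quasirandom {k} {s} l π →
      ∃ λ Δ → after (toList (target {k} {s} π Δ)) w ≡ []
    Good⇒finished {l} large {Q} {w} {π} good π∈ qr with any? (λ Δ → ≡[]? (after (toList (target {k} {s} π Δ)) w))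
    ... | yes p = p
    ... | no ¬p = ⊥-elim (<⇒≱ weight< (≤-trans (^-monoʳ-≤ 64 U≤) (64^distinctMisses≤weight (targets π) w)))
      where
      length-targets : length (targets π) ≡ s
      length-targets = length-tabulate (λ Δ → toList (target π Δ))
      weight< : weight (targets π) w < 64 ^ U
      weight< = *-cancelˡ-< (64 ^ ℓ) _ _ (≤-<-trans (*-monoʳ-≤ (64 ^ ℓ) (∑-∈ (λ π → weight (targets π) w) π∈))
        (≤-<-trans (m≤n+m _ _) good))
      runWeight< : runWeight w < 64 ^ ℓ
      runWeight< = *-cancelʳ-< (64 ^ U) _ _ (≤-<-trans (m≤m+n _ _) good)
      lower : s * k ≤ distinctMisses (targets π) w + s * (s * (ℓ * l))
      lower = subst (λ z → z * k ≤ distinctMisses (targets π) w + z * (z * (ℓ * l))) length-targets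
        (distinctMisses-lower ℓ l k k w (runWeight<⇒ShortRuns ℓ w runWeight<) C≡k+k (targets π)
          (AllPairs.tabulate⁺-< (λ {Δ} {Δ′} p → <⇒≤ (qr Δ Δ′ p)))
          (All.tabulate⁺ (λ Δ → length-toList (target π Δ) , λ e → ¬p (Δ , e))))
      U≤ : U ≤ distinctMisses (targets π) w
      U≤ = +-cancelʳ-≤ (s * (s * (ℓ * l))) _ _ (≤-trans (≤-reflexive (+-comm U _)) (≤-trans large lower))

    -- One good `v` suffices, since containment concerns `σ` alone. A bad `σ` therefore yields a bad
    -- word for every `v`, so that pairs of a bad `σ` and any `v` inject into the bad words.
    someGood? : ∀ Q σ → Dec (Any (λ v → Good Q (word v σ)) (increasing n (R * W)))
    someGood? Q σ = Any.any? (λ v → score Q (word v σ) <? 64 ^ ℓ * 64 ^ U) (increasing n (R * W))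

    goodPerms badPerms : List (Vec (Fin k) k) → List (Vec (Fin n) n)
    goodPerms Q = filter (someGood? Q) (perms n)
    badPerms  Q = filter (λ σ → ¬? (someGood? Q σ)) (perms n)

    goodPerms-contain : ∀ {l} → s * (s * (ℓ * l)) + U ≤ s * k → ∀ {Q} → (∀ {π} → π ∈ Q → IsPerm π × Quasirandom {k} {s} l π) →
      ∀ {σ π} → σ ∈ goodPerms Q → π ∈ Q → Contains σ π
    goodPerms-contain large {Q} hQ {σ} {π} σ∈ π∈ with find (proj₂ (∈-filter⁻ (someGood? Q) {xs = perms n} σ∈))
    ... | v , v∈ , good with Good⇒finished large {Q} {word v σ} {π} good π∈ (proj₂ (hQ π∈))
    ...   | Δ , fin = finished⇒Embeds {v} {σ} {π} (increasing-sound n (R * W) v∈) (proj₁ (hQ π∈)) Δ fin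

    ∑-score : R * 6 ≤ H → ∀ Q → ∑ (words C) (score Q) ≤ (C * (R * suc C) * 64 ^ U + 64 ^ ℓ * (length Q * 2 ^ (s * C))) * (R * W) ^ n
    ∑-score R*6≤H Q = begin
      ∑ (words C) (score Q)
        ≡⟨ trans (∑-+ (words C) _ _) (cong₂ _+_ (∑-*ʳ (words C) (64 ^ U) runWeight) (∑-*ˡ (words C) (64 ^ ℓ) _)) ⟩
      ∑ (words C) runWeight * 64 ^ U + 64 ^ ℓ * ∑ (words C) (λ w → ∑ Q (λ π → weight (targets π) w))
        ≡⟨ cong (λ z → ∑ (words C) runWeight * 64 ^ U + 64 ^ ℓ * z) (∑-swap (words C) Q _) ⟩
      ∑ (words C) runWeight * 64 ^ U + 64 ^ ℓ * ∑ Q (λ π → ∑ (words C) (weight (targets π)))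
        ≤⟨ +-mono-≤ (*-monoˡ-≤ (64 ^ U) (∑-runWeight R*6≤H C)) (*-monoʳ-≤ (64 ^ ℓ) (∑-mono Q (λ π →
             ∑-weight R*6≤H C {s} (targets π) (≤-reflexive (length-tabulate (λ Δ → toList (target π Δ))))))) ⟩
      C * (R * suc C) * N ^ C * 64 ^ U + 64 ^ ℓ * ∑ Q (λ _ → (2 ^ s * N) ^ C)
        ≡⟨ cong (λ z → C * (R * suc C) * N ^ C * 64 ^ U + 64 ^ ℓ * z) (trans (∑-const Q _) (cong (length Q *_)
             (trans (^-distribʳ-* (2 ^ s) N C) (cong (_* N ^ C) (^-*-assoc 2 s C))))) ⟩
      C * (R * suc C) * N ^ C * 64 ^ U + 64 ^ ℓ * (length Q * (2 ^ (s * C) * N ^ C))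
        ≡⟨ collect (C * (R * suc C)) (N ^ C) (64 ^ U) (64 ^ ℓ) (length Q) (2 ^ (s * C)) ⟩
      (C * (R * suc C) * 64 ^ U + 64 ^ ℓ * (length Q * 2 ^ (s * C))) * N ^ C
        ≡⟨ cong ((C * (R * suc C) * 64 ^ U + 64 ^ ℓ * (length Q * 2 ^ (s * C))) *_)
             (trans (^-*-assoc (R * W) H C) (cong ((R * W) ^_) (trans (*-comm H C) C*H≡n))) ⟩
      (C * (R * suc C) * 64 ^ U + 64 ^ ℓ * (length Q * 2 ^ (s * C))) * (R * W) ^ n ∎
      where
      open ≤-Reasoning
      collect : ∀ c x u e q p → c * x * u + e * (q * (p * x)) ≡ (c * u + e * (q * p)) * x
      collect = solve-∀

    length-badPerms : R * 6 ≤ H → ∀ Q →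
      length (badPerms Q) * length (increasing n (R * W)) * (64 ^ ℓ * 64 ^ U)
        ≤ (C * (R * suc C) * 64 ^ U + 64 ^ ℓ * (length Q * 2 ^ (s * C))) * (R * W) ^ n
    length-badPerms R*6≤H Q = begin
      length (badPerms Q) * length (increasing n (R * W)) * (64 ^ ℓ * 64 ^ U)
        ≡⟨ cong (_* (64 ^ ℓ * 64 ^ U)) (length-cartesianProductWith _,_ (badPerms Q) (increasing n (R * W))) ⟨
      length pairs * (64 ^ ℓ * 64 ^ U)
        ≤⟨ *-monoˡ-≤ (64 ^ ℓ * 64 ^ U) (injection⇒length≤ (λ (σ , v) → word v σ)
             (Unique.cartesianProduct⁺ (Unique.filter⁺ _ (perms-unique n)) (increasing-unique n (R * W))) injective bad) ⟩
      length (filter (λ w → 64 ^ ℓ * 64 ^ U ≤? score Q w) (words C)) * (64 ^ ℓ * 64 ^ U)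
        ≤⟨ markov (λ w → 64 ^ ℓ * 64 ^ U ≤? score Q w) (64 ^ ℓ * 64 ^ U) (score Q) (λ p → p) (words C) ⟩
      ∑ (words C) (score Q)
        ≤⟨ ∑-score R*6≤H Q ⟩
      (C * (R * suc C) * 64 ^ U + 64 ^ ℓ * (length Q * 2 ^ (s * C))) * (R * W) ^ n ∎
      where
      open ≤-Reasoning
      pairs = cartesianProduct (badPerms Q) (increasing n (R * W))
      sound : ∀ {σ v} → (σ , v) ∈ pairs → IsPerm σ × Increasing v
      sound p with ∈-cartesianProduct⁻ (badPerms Q) (increasing n (R * W)) p
      ... | σ∈ , v∈ = perms-sound n (proj₁ (∈-filter⁻ (λ σ → ¬? (someGood? Q σ)) {xs = perms n} σ∈)) , increasing-sound n (R * W) v∈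
      injective : ∀ {x y} → x ∈ pairs → y ∈ pairs → word (proj₂ x) (proj₁ x) ≡ word (proj₂ y) (proj₁ y) → x ≡ y
      injective {σ , v} {σ′ , v′} p q e with word-injective {v} {v′} {σ} {σ′} (proj₂ (sound p)) (proj₂ (sound q)) (proj₁ (sound p)) (proj₁ (sound q)) e
      ... | refl , refl = refl
      bad : ∀ {x} → x ∈ pairs → word (proj₂ x) (proj₁ x) ∈ filter (λ w → 64 ^ ℓ * 64 ^ U ≤? score Q w) (words C)
      bad {σ , v} p with ∈-cartesianProduct⁻ (badPerms Q) (increasing n (R * W)) p
      ... | σ∈ , v∈ = ∈-filter⁺ _ (∈-vecs (∈-vecs (λ (x , y) → ∈-cartesianProduct⁺ (∈-allFin x) (∈-allFin y))) (word v σ))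
        (≮⇒≥ (λ good → proj₂ (∈-filter⁻ (λ σ → ¬? (someGood? Q σ)) {xs = perms n} σ∈) (lose v∈ good)))

    -- The 4 is `2 * 2`: only half of all words need be of the form `v ∘ σ`, and the score has two
    -- summands.
    m*length-badPerms≤n! : ∀ m Q → R * 6 ≤ H → 0 < R * W → n ≤ R * W → 2 * (n * n) ≤ R * W →
      4 * m * (C * (R * suc C)) ≤ 64 ^ ℓ → 4 * m * (length Q * 2 ^ (s * C)) ≤ 64 ^ U →
      m * length (badPerms Q) ≤ n !
    m*length-badPerms≤n! m Q R*6≤H M>0 n≤M 2n²≤M runs≤ weights≤ =
      *-cancelˡ-≤ (2 * T) {{m*n≢0 2 T {{_}} {{T≢0}}}} (*-cancelʳ-≤ _ _ (M ^ n) {{m^n≢0 M n {{>-nonZero M>0}}}} (begin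
        2 * T * (m * b) * M ^ n                        ≤⟨ *-monoʳ-≤ (2 * T * (m * b)) (M^n≤2*increasing*n! n M M>0 n≤M 2n²≤M) ⟩
        2 * T * (m * b) * (2 * (v * n !))              ≡⟨ regroup T m b v (n !) ⟩
        4 * m * n ! * (b * v * T)                      ≤⟨ *-monoʳ-≤ (4 * m * n !) (length-badPerms R*6≤H Q) ⟩
        4 * m * n ! * ((c * 64 ^ U + 64 ^ ℓ * q) * M ^ n)   ≡⟨ distribute m (n !) c (64 ^ U) (64 ^ ℓ) q (M ^ n) ⟩
        (4 * m * c * 64 ^ U + 64 ^ ℓ * (4 * m * q)) * n ! * M ^ n
          ≤⟨ *-monoˡ-≤ (M ^ n) (*-monoˡ-≤ (n !) (+-mono-≤ (*-monoˡ-≤ (64 ^ U) runs≤) (*-monoʳ-≤ (64 ^ ℓ) weights≤))) ⟩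
        (T + T) * n ! * M ^ n                          ≡⟨ cong (λ z → (T + z) * n ! * M ^ n) (+-identityʳ T) ⟨
        2 * T * n ! * M ^ n                            ∎))
      where
      open ≤-Reasoning
      M = R * W
      T = 64 ^ ℓ * 64 ^ U
      b = length (badPerms Q)
      v = length (increasing n M)
      c = C * (R * suc C)
      q = length Q * 2 ^ (s * C)
      T≢0 : NonZero T
      T≢0 = m*n≢0 (64 ^ ℓ) (64 ^ U) {{m^n≢0 64 ℓ}} {{m^n≢0 64 U}}
      regroup : ∀ t m b v f → 2 * t * (m * b) * (2 * (v * f)) ≡ 4 * m * f * (b * v * t)
      regroup = solve-∀
      distribute : ∀ m f c u e q x → 4 * m * f * ((c * u + e * q) * x) ≡ (4 * m * c * u + e * (4 * m * q)) * f * x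
      distribute = solve-∀

complement-bound : ∀ m {g b t} → g + b ≡ t → m * b ≤ t → (m ∸ 1) * t ≤ m * g
complement-bound zero    _ _ = z≤n
complement-bound (suc m) {g} {b} {t} refl p = +-cancelʳ-≤ (suc m * b) _ _ (begin
  m * (g + b) + suc m * b     ≤⟨ +-monoʳ-≤ (m * (g + b)) p ⟩
  m * (g + b) + (g + b)       ≡⟨ collect m g b ⟩
  suc m * g + suc m * b       ∎)
  where
  open ≤-Reasoning
  collect : ∀ m g b → m * (g + b) + (g + b) ≡ suc m * g + suc m * b
  collect = solve-∀

-- Choice of parameters

n<2^n : ∀ n → n < 2 ^ n
n<2^n zero    = s≤s z≤n
n<2^n (suc n) = +-mono-≤-< (m^n>0 2 n) (≤-trans (n<2^n n) (m≤m+n _ _))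

-- Bernoulli gives a factor 2 for exponents up to half of `suc l`, so the exponent `l` is split into
-- two halves; 4 takes the place of `e`.
[1+l]^l≤4*l^l : ∀ l → suc l ^ l ≤ 4 * l ^ l
[1+l]^l≤4*l^l l = begin
  suc l ^ l                           ≡⟨ split (suc l) ⟩
  suc l ^ ⌊ l /2⌋ * suc l ^ ⌈ l /2⌉   ≤⟨ *-mono-≤ (half ⌊ l /2⌋ (≤-trans (+-monoʳ-≤ ⌊ l /2⌋ (⌊n/2⌋≤⌈n/2⌉ l)) (≤-trans (≤-reflexive (⌊n/2⌋+⌈n/2⌉≡n l)) (n≤1+n l))))
                                                  (half ⌈ l /2⌉ (≤-trans (+-monoʳ-≤ ⌈ l /2⌉ (⌊n/2⌋≤⌈n/2⌉ (suc l))) (≤-reflexive (⌊n/2⌋+⌈n/2⌉≡n (suc l))))) ⟩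
  2 * l ^ ⌊ l /2⌋ * (2 * l ^ ⌈ l /2⌉) ≡⟨ collect (l ^ ⌊ l /2⌋) (l ^ ⌈ l /2⌉) ⟩
  4 * (l ^ ⌊ l /2⌋ * l ^ ⌈ l /2⌉)     ≡⟨ cong (4 *_) (split l) ⟨
  4 * l ^ l                           ∎
  where
  open ≤-Reasoning
  split : ∀ x → x ^ l ≡ x ^ ⌊ l /2⌋ * x ^ ⌈ l /2⌉
  split x = trans (cong (x ^_) (sym (⌊n/2⌋+⌈n/2⌉≡n l))) (^-distribˡ-+-* x ⌊ l /2⌋ ⌈ l /2⌉)
  half : ∀ h → h + h ≤ suc l → suc l ^ h ≤ 2 * l ^ h
  half h p = subst (λ z → z ^ h ≤ 2 * l ^ h) (+-comm l 1) ([y+d]^j≤2*y^j l 1 h (subst (0 <_) (+-comm 1 l) (s≤s z≤n))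
    (≤-trans (≤-reflexive (double h)) (≤-trans p (≤-reflexive (+-comm 1 l)))))
    where
    double : ∀ h → 2 * (h * 1) ≡ h + h
    double = solve-∀
  collect : ∀ a b → 2 * a * (2 * b) ≡ 4 * (a * b)
  collect = solve-∀

l^l≤4^l*l! : ∀ l → l ^ l ≤ 4 ^ l * l !
l^l≤4^l*l! zero    = ≤-refl
l^l≤4^l*l! (suc l) = begin
  suc l * suc l ^ l               ≤⟨ *-monoʳ-≤ (suc l) ([1+l]^l≤4*l^l l) ⟩
  suc l * (4 * l ^ l)             ≤⟨ *-monoʳ-≤ (suc l) (*-monoʳ-≤ 4 (l^l≤4^l*l! l)) ⟩
  suc l * (4 * (4 ^ l * l !))     ≡⟨ regroup (suc l) 4 (4 ^ l) (l !) ⟩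
  4 ^ suc l * suc l !             ∎
  where
  open ≤-Reasoning
  regroup : ∀ a c b d → a * (c * (b * d)) ≡ c * b * (a * d)
  regroup = solve-∀

n!≤n^n : ∀ n → n ! ≤ n ^ n
n!≤n^n zero    = ≤-refl
n!≤n^n (suc n) = *-monoʳ-≤ (suc n) (≤-trans (n!≤n^n n) (^-monoˡ-≤ n (n≤1+n n)))

-- By `l ! ≥ (l/4)^l` the exceptional share is at most `s^2 (64 k^2 / l^3)^l`, and 128 in place of
-- 64 turns this into `s^2 / 2^l`.
factorial-cube-bound : ∀ k s l m x → 128 * (k * k) ≤ l * (l * l) → m * (s * s) ≤ 2 ^ l → 0 < k → 0 < s →
  x * (l ! * l ! * l !) ≤ s * s * (k ^ l * k ^ l) * k ! → m * x ≤ k !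
factorial-cube-bound k s l m x kl ms k>0 s>0 h = *-cancelˡ-≤ (s * s) {{m*n≢0 s s {{>-nonZero s>0}} {{>-nonZero s>0}}}} (begin
  s * s * (m * x)      ≡⟨ regroup₁ (s * s) m x ⟩
  x * (m * (s * s))    ≤⟨ *-monoʳ-≤ x ms ⟩
  x * 2 ^ l            ≤⟨ *-cancelʳ-≤ (x * 2 ^ l) (s * s * k !) y {{y≢0}} main ⟩
  s * s * k !          ∎)
  where
  open ≤-Reasoning
  y = 64 ^ l * (k ^ l * k ^ l)
  y≢0 : NonZero y
  y≢0 = m*n≢0 (64 ^ l) _ {{m^n≢0 64 l}} {{m*n≢0 (k ^ l) (k ^ l) {{m^n≢0 k l {{>-nonZero k>0}}}} {{m^n≢0 k l {{>-nonZero k>0}}}}}}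
  regroup₁ : ∀ a b c → a * (b * c) ≡ c * (b * a)
  regroup₁ = solve-∀
  pow* : ∀ a b → (a * b) ^ l ≡ a ^ l * b ^ l
  pow* a b = ^-distribʳ-* a b l
  cube : (4 ^ l * l !) * ((4 ^ l * l !) * (4 ^ l * l !)) ≡ 64 ^ l * (l ! * l ! * l !)
  cube = trans (regroup (4 ^ l) (l !)) (cong (_* (l ! * l ! * l !)) (sym (trans (pow* 4 16) (cong (4 ^ l *_) (pow* 4 4)))))
    where
    regroup : ∀ a f → (a * f) * ((a * f) * (a * f)) ≡ a * (a * a) * (f * f * f)
    regroup = solve-∀
  main : x * 2 ^ l * y ≤ s * s * k ! * y
  main = begin
    x * 2 ^ l * (64 ^ l * (k ^ l * k ^ l))        ≡⟨ *-assoc x (2 ^ l) _ ⟩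
    x * (2 ^ l * (64 ^ l * (k ^ l * k ^ l)))      ≡⟨ cong (x *_) (trans (sym (*-assoc (2 ^ l) (64 ^ l) _)) (cong₂ _*_ (sym (pow* 2 64)) (sym (pow* k k)))) ⟩
    x * (128 ^ l * (k * k) ^ l)                   ≡⟨ cong (x *_) (pow* 128 (k * k)) ⟨
    x * (128 * (k * k)) ^ l                       ≤⟨ *-monoʳ-≤ x (^-monoˡ-≤ l kl) ⟩
    x * (l * (l * l)) ^ l                         ≡⟨ cong (x *_) (trans (pow* l (l * l)) (cong (l ^ l *_) (pow* l l))) ⟩
    x * (l ^ l * (l ^ l * l ^ l))                 ≤⟨ *-monoʳ-≤ x (*-mono-≤ (l^l≤4^l*l! l) (*-mono-≤ (l^l≤4^l*l! l) (l^l≤4^l*l! l))) ⟩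
    x * ((4 ^ l * l !) * ((4 ^ l * l !) * (4 ^ l * l !)))   ≡⟨ cong (x *_) cube ⟩
    x * (64 ^ l * (l ! * l ! * l !))              ≡⟨ regroup₂ x (64 ^ l) _ ⟩
    64 ^ l * (x * (l ! * l ! * l !))              ≤⟨ *-monoʳ-≤ (64 ^ l) h ⟩
    64 ^ l * (s * s * (k ^ l * k ^ l) * k !)      ≡⟨ regroup₃ (64 ^ l) (s * s) (k ^ l * k ^ l) (k !) ⟩
    s * s * k ! * y                               ∎
    where
    regroup₂ : ∀ a b c → a * (b * c) ≡ b * (a * c)
    regroup₂ = solve-∀
    regroup₃ : ∀ a b c d → a * (b * c * d) ≡ b * d * (a * c)
    regroup₃ = solve-∀

bits : ℕ → ℕ
bits zero    = 1
bits (suc n) with 2 ^ bits n ≤? suc n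
... | yes _ = suc (bits n)
... | no  _ = bits n

n<2^bits : ∀ n → n < 2 ^ bits n
n<2^bits zero    = s≤s z≤n
n<2^bits (suc n) with 2 ^ bits n ≤? suc n
... | yes _ = ≤-trans (s≤s (n<2^bits n)) (≤-trans (+-monoˡ-≤ _ (m^n>0 2 (bits n))) (+-monoʳ-≤ (2 ^ bits n) (m≤m+n _ 0)))
... | no ¬p = ≰⇒> ¬p

2^bits≤ : ∀ n → 2 ^ bits n ≤ 2 * suc n
2^bits≤ zero    = ≤-refl
2^bits≤ (suc n) with 2 ^ bits n ≤? suc n
... | yes p = *-monoʳ-≤ 2 (≤-trans p (n≤1+n (suc n)))
... | no  _ = ≤-trans (2^bits≤ n) (*-monoʳ-≤ 2 (n≤1+n (suc n)))

-- Passing from `t` to `t + 1` at most doubles the left side, because `2 * p ≤ t + 1`.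
t^p≤2^t : ∀ a p → 2 * p ≤ suc a → a ^ p ≤ 2 ^ a → ∀ j → (j + a) ^ p ≤ 2 ^ (j + a)
t^p≤2^t a p q base zero    = base
t^p≤2^t a p q base (suc j) = ≤-trans (subst (λ z → z ^ p ≤ 2 * t ^ p) (+-comm t 1)
    ([y+d]^j≤2*y^j t 1 p (subst (0 <_) (+-comm 1 t) (s≤s z≤n))
      (≤-trans (≤-reflexive (cong (2 *_) (*-identityʳ p))) (≤-trans q (≤-trans (s≤s (m≤n+m a j)) (≤-reflexive (+-comm 1 t)))))))
  (*-monoʳ-≤ 2 (t^p≤2^t a p q base j))
  where t = j + a

-- Inequalities between the parameters

module Parameters (k t m : ℕ) (k>0 : 0 < k) (k<2^t : k < 2 ^ t) (2^t≤4k : 2 ^ t ≤ 4 * k)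
                  (128≤t : 128 ≤ t) (4m≤t : 4 * m ≤ t) where

  open ≤-Reasoning

  -- Here `ℓ` bounds common subsequences, while runs are bounded by `s`. As `d` exceeds
  -- `2 * (s * s)`, the overlaps take at most half of the `s * k` misses.
  s d ℓ q : ℕ
  s = 2 * t
  d = suc (2 * (s * s))
  ℓ = k / d
  q = s * s

  t^11≤2^t : t ^ 11 ≤ 2 ^ t
  -- The base case at 128 holds as `128 ^ 11` is `2 ^ 77`.
  t^11≤2^t = subst (λ z → z ^ 11 ≤ 2 ^ z) (m∸n+n≡m 128≤t) (t^p≤2^t 128 11 (≤ᵇ⇒≤ 22 129 _) (≤ᵇ⇒≤ (128 ^ 11) (2 ^ 128) _) (t ∸ 128))

  1≤t : 1 ≤ t
  1≤t = ≤-trans (s≤s z≤n) 128≤t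

  1≤s : 1 ≤ s
  1≤s = ≤-trans 1≤t (m≤m+n t _)

  1≤q : 1 ≤ q
  1≤q = *-mono-≤ 1≤s 1≤s

  s≤q : s ≤ q
  s≤q = ≤-trans (≤-reflexive (sym (*-identityʳ s))) (*-monoʳ-≤ s 1≤s)

  q≤q³ : q ≤ q * (q * q)
  q≤q³ = ≤-trans (≤-reflexive (sym (*-identityʳ q))) (*-monoʳ-≤ q (*-mono-≤ 1≤q 1≤q))

  -- The factor 128 serves `128k²≤ℓ³`, and 216 is the cube of the 6 in `k≤6qℓ`. As `q^3` is
  -- `64 t^6`, the left side times 4 is at most `t^(1+1+2+1+6)`.
  large : 128 * (216 * (q * (q * q))) ≤ k
  large = *-cancelˡ-≤ 4 (begin
    4 * (128 * (216 * (q * (q * q))))               ≤⟨ absorb 4 128 216 64 t t⁶ (q * (q * q)) (sixth t)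
        (≤-trans (≤ᵇ⇒≤ 4 128 _) 128≤t) 128≤t
        (≤-trans (≤ᵇ⇒≤ 216 (128 * 128) _) (*-mono-≤ 128≤t 128≤t)) (≤-trans (≤ᵇ⇒≤ 64 128 _) 128≤t) ⟩
    t * (t * (t * t * (t * t⁶)))                    ≡⟨ cong (λ z → t * (t * z)) (*-assoc t t (t * t⁶)) ⟩
    t ^ 11                                          ≤⟨ t^11≤2^t ⟩
    2 ^ t                                           ≤⟨ 2^t≤4k ⟩
    4 * k                                           ∎)
    where
    t⁶ = t ^ 6
    absorb : ∀ a b c e t x y → y ≡ e * x → a ≤ t → b ≤ t → c ≤ t * t → e ≤ t →
      a * (b * (c * y)) ≤ t * (t * (t * t * (t * x)))
    absorb a b c e t x y refl a≤ b≤ c≤ e≤ = *-mono-≤ a≤ (*-mono-≤ b≤ (*-mono-≤ c≤ (*-monoˡ-≤ x e≤)))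
    sixth : ∀ t → 2 * t * (2 * t) * (2 * t * (2 * t) * (2 * t * (2 * t))) ≡ 64 * (t * (t * (t * (t * (t * (t * 1))))))
    sixth = solve-∀

  216q³≤k : 216 * (q * (q * q)) ≤ k
  216q³≤k = ≤-trans (m≤m+n _ _) large

  c*q³≤k : ∀ c → c ≤ 216 → c * (q * (q * q)) ≤ k
  c*q³≤k c p = ≤-trans (*-monoˡ-≤ (q * (q * q)) p) 216q³≤k

  d≤3q : d ≤ 3 * q
  d≤3q = +-monoˡ-≤ (2 * q) 1≤q

  d≤k : d ≤ k
  d≤k = ≤-trans d≤3q (≤-trans (*-monoʳ-≤ 3 q≤q³) (c*q³≤k 3 (≤ᵇ⇒≤ 3 216 _)))

  1≤ℓ : 1 ≤ ℓ
  1≤ℓ = m≥n⇒m/n>0 d≤k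

  2qℓ≤k : 2 * q * ℓ ≤ k
  2qℓ≤k = ≤-trans (*-monoˡ-≤ ℓ (n≤1+n (2 * q))) (≤-trans (≤-reflexive (*-comm d ℓ)) (m/n*n≤m k d))

  k≤6qℓ : k ≤ 6 * q * ℓ
  k≤6qℓ = begin
    k                    ≡⟨ m≡m%n+[m/n]*n k d ⟩
    k % d + ℓ * d        ≤⟨ +-monoˡ-≤ (ℓ * d) (<⇒≤ (m%n<n k d)) ⟩
    -- The remainder is absorbed by a second copy of `ℓ * d`, since `ℓ` is at least 1.
    d + ℓ * d            ≤⟨ +-monoˡ-≤ (ℓ * d) (≤-trans (≤-reflexive (sym (+-identityʳ d))) (*-monoˡ-≤ d 1≤ℓ)) ⟩
    ℓ * d + ℓ * d        ≤⟨ +-mono-≤ (*-monoʳ-≤ ℓ d≤3q) (*-monoʳ-≤ ℓ d≤3q) ⟩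
    ℓ * (3 * q) + ℓ * (3 * q)   ≡⟨ collect ℓ q ⟩
    6 * q * ℓ            ∎
    where
    collect : ∀ ℓ q → ℓ * (3 * q) + ℓ * (3 * q) ≡ 6 * q * ℓ
    collect = solve-∀

  q≢0 : NonZero q
  q≢0 = >-nonZero 1≤q

  128k²≤ℓ³ : 128 * (k * k) ≤ ℓ * (ℓ * ℓ)
  128k²≤ℓ³ = *-cancelˡ-≤ (216 * q³) {{m*n≢0 216 q³ {{_}} {{>-nonZero (*-mono-≤ 1≤q (*-mono-≤ 1≤q 1≤q))}}}} (begin
    216 * q³ * (128 * (k * k))            ≡⟨ regroup (216 * q³) 128 (k * k) ⟩
    128 * (216 * q³) * (k * k)            ≤⟨ *-monoˡ-≤ (k * k) large ⟩
    k * (k * k)                           ≤⟨ *-mono-≤ k≤6qℓ (*-mono-≤ k≤6qℓ k≤6qℓ) ⟩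
    6 * q * ℓ * (6 * q * ℓ * (6 * q * ℓ)) ≡⟨ cube q ℓ ⟩
    216 * q³ * (ℓ * (ℓ * ℓ))              ∎)
    where
    q³ = q * (q * q)
    regroup : ∀ a b c → a * (b * c) ≡ b * a * c
    regroup = solve-∀
    cube : ∀ q ℓ → 6 * q * ℓ * (6 * q * ℓ * (6 * q * ℓ)) ≡ 216 * (q * (q * q)) * (ℓ * (ℓ * ℓ))
    cube = solve-∀

  m≤t : m ≤ t
  m≤t = ≤-trans (m≤m+n m _) 4m≤t

  mq≤2^ℓ : m * q ≤ 2 ^ ℓ
  mq≤2^ℓ = begin
    m * q      ≤⟨ *-monoˡ-≤ q (≤-trans m≤t (≤-trans (m≤m+n t _) s≤q)) ⟩
    q * q      ≤⟨ *-cancelˡ-≤ (6 * q) {{m*n≢0 6 q {{_}} {{q≢0}}}} (≤-trans (≤-reflexive (*-assoc 6 q (q * q))) (≤-trans (c*q³≤k 6 (≤ᵇ⇒≤ 6 216 _)) k≤6qℓ)) ⟩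
    ℓ          ≤⟨ <⇒≤ (n<2^n ℓ) ⟩
    2 ^ ℓ      ∎

  overlaps≤ : s * (s * (s * ℓ)) + t * k ≤ s * k
  overlaps≤ = begin
    s * (s * (s * ℓ)) + t * k      ≡⟨ cong (_+ t * k) (regroup t s ℓ) ⟩
    t * (2 * (s * s) * ℓ) + t * k  ≤⟨ +-monoˡ-≤ (t * k) (*-monoʳ-≤ t 2qℓ≤k) ⟩
    t * k + t * k                  ≡⟨ double t k ⟩
    s * k                          ∎
    where
    regroup : ∀ t s ℓ → 2 * t * (s * (s * ℓ)) ≡ t * (2 * (s * s) * ℓ)
    regroup = solve-∀
    double : ∀ t k → t * k + t * k ≡ 2 * t * k
    double = solve-∀

  6s≤k : 6 * s ≤ k
  6s≤k = ≤-trans (*-monoʳ-≤ 6 (≤-trans s≤q q≤q³)) (c*q³≤k 6 (≤ᵇ⇒≤ 6 216 _))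

  R*6≤H : (k + s) * 6 ≤ 10 * k
  R*6≤H = begin
    (k + s) * 6          ≡⟨ expand k s ⟩
    6 * k + 6 * s        ≤⟨ +-monoʳ-≤ (6 * k) 6s≤k ⟩
    6 * k + k            ≤⟨ m≤m+n _ (3 * k) ⟩
    6 * k + k + 3 * k    ≡⟨ collect k ⟩
    10 * k               ∎
    where
    expand : ∀ k s → (k + s) * 6 ≡ 6 * k + 6 * s
    expand = solve-∀
    collect : ∀ k → 6 * k + k + 3 * k ≡ 10 * k
    collect = solve-∀

  P : ℕ
  P = 2 ^ t

  t<P : t < P
  t<P = n<2^n t

  4m≤P : 4 * m ≤ P
  4m≤P = ≤-trans 4m≤t (<⇒≤ t<P)

  3≤P : 3 ≤ P
  3≤P = ≤-trans (≤-trans (≤ᵇ⇒≤ 3 128 _) 128≤t) (<⇒≤ t<P)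

  64^[a*t] : ∀ a → 64 ^ (a * t) ≡ P ^ (6 * a)
  64^[a*t] a = trans (^-*-assoc 2 6 (a * t)) (trans (cong (2 ^_) (regroup a t)) (sym (^-*-assoc 2 t (6 * a))))
    where
    regroup : ∀ a t → 6 * (a * t) ≡ t * (6 * a)
    regroup = solve-∀

  -- Polynomially many rows and starting columns: `P ^ 7` is needed, and runs of length `s = 2t`
  -- provide `P ^ 12`.
  runs≤ : 4 * m * ((k + k) * ((k + s) * suc (k + k))) ≤ 64 ^ s
  runs≤ = begin
    4 * m * ((k + k) * ((k + s) * suc (k + k)))   ≤⟨ *-mono-≤ 4m≤P (*-mono-≤ 2k≤ (*-mono-≤ R≤ 1+2k≤)) ⟩
    P * (P * P * (P * P * (P * P)))               ≡⟨ seventh P ⟩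
    P ^ 7                                         ≤⟨ ^-monoʳ-≤ P {{>-nonZero (≤-trans (s≤s z≤n) 3≤P)}} (≤ᵇ⇒≤ 7 12 _) ⟩
    P ^ 12                                        ≡⟨ 64^[a*t] 2 ⟨
    64 ^ s                                        ∎
    where
    k≤P = <⇒≤ k<2^t
    2P≤ : P + P ≤ P * P
    2P≤ = ≤-trans (≤-reflexive (cong (P +_) (sym (+-identityʳ P)))) (*-monoˡ-≤ P (≤-trans (≤ᵇ⇒≤ 2 3 _) 3≤P))
    2k≤ : k + k ≤ P * P
    2k≤ = ≤-trans (+-mono-≤ k≤P k≤P) 2P≤
    1+2k≤ : suc (k + k) ≤ P * P
    1+2k≤ = ≤-trans (+-mono-≤ k<2^t k≤P) 2P≤
    R≤ : k + s ≤ P * P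
    R≤ = ≤-trans (+-mono-≤ k≤P (*-monoʳ-≤ 2 (<⇒≤ t<P))) (*-monoˡ-≤ P 3≤P)
    seventh : ∀ P → P * (P * P * (P * P * (P * P))) ≡ P * (P * (P * (P * (P * (P * (P * 1))))))
    seventh = solve-∀

  -- The exponents of `P` add up exactly: `k` for `4 * m`, `k` for the number of patterns and
  -- `4 * k` for the mean weight, against `6 * k` from `64 ^ (t * k)`.
  weights≤ : ∀ {x} → x ≤ k ! → 4 * m * (x * 2 ^ (s * (k + k))) ≤ 64 ^ (t * k)
  weights≤ {x} x≤ = begin
    4 * m * (x * 2 ^ (s * (k + k)))   ≤⟨ *-mono-≤ (≤-trans 4m≤P P≤P^k) (*-mono-≤ (≤-trans x≤ (≤-trans (n!≤n^n k) (^-monoˡ-≤ k (<⇒≤ k<2^t))))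
                                          (≤-reflexive (trans (cong (2 ^_) (regroup t k)) (sym (^-*-assoc 2 t (4 * k)))))) ⟩
    P ^ k * (P ^ k * P ^ (4 * k))     ≡⟨ trans (cong (P ^ k *_) (sym (^-distribˡ-+-* P k (4 * k)))) (sym (^-distribˡ-+-* P k (k + 4 * k))) ⟩
    P ^ (6 * k)                       ≡⟨ 64^[a*t] k ⟨
    64 ^ (k * t)                      ≡⟨ cong (64 ^_) (*-comm k t) ⟩
    64 ^ (t * k)                      ∎
    where
    P≤P^k : P ≤ P ^ k
    P≤P^k = ≤-trans (≤-reflexive (sym (*-identityʳ P))) (^-monoʳ-≤ P {{>-nonZero (≤-trans (s≤s z≤n) 3≤P)}} k>0)
    regroup : ∀ t k → 2 * t * (k + k) ≡ t * (4 * k)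
    regroup = solve-∀

-- Universality of typical permutations

quasirandomPerms : ∀ k s l → List (Vec (Fin k) k)
quasirandomPerms k s l = filter (quasirandom? {k} {s} l) (perms k)

module Universality (k t m C H n : ℕ) (C≡k+k : C ≡ k + k) (H≡10k : H ≡ 10 * k) (C*H≡n : C * H ≡ n)
  (k>0 : 0 < k) (k<2^t : k < 2 ^ t) (2^t≤4k : 2 ^ t ≤ 4 * k) (128≤t : 128 ≤ t) (4m≤t : 4 * m ≤ t) where

  open Parameters k t m k>0 k<2^t 2^t≤4k 128≤t 4m≤t

  Q : List (Vec (Fin k) k)
  Q = quasirandomPerms k s ℓ

  open Embedding k s (suc (2 * (n * n))) C H n C≡k+k C*H≡n using (goodPerms; badPerms; someGood?; goodPerms-contain; m*length-badPerms≤n!)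

  L : List (Vec (Fin n) n)
  L = goodPerms s (t * k) Q

  Q-large : (m ∸ 1) * k ! ≤ m * length Q
  Q-large = complement-bound m (trans (length-filter-complement (quasirandom? {k} {s} ℓ) (perms k)) (length-perms k))
    (factorial-cube-bound k s ℓ m _ 128k²≤ℓ³ mq≤2^ℓ k>0 1≤s (length-nonQuasirandom {k} {s} ℓ))

  L-unique : Unique L
  L-unique = Unique.filter⁺ (someGood? s (t * k) Q) (perms-unique n)

  L-perms : All IsPerm L
  L-perms = All.tabulate (λ σ∈ → perms-sound n (proj₁ (∈-filter⁻ (someGood? s (t * k) Q) {xs = perms n} σ∈)))

  L-contain : All (λ σ → All (λ π → Contains σ π) Q) L
  L-contain = All.tabulate (λ σ∈ → All.tabulate (λ π∈ → goodPerms-contain s (t * k) {ℓ} overlaps≤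
    (λ π∈ → let π∈perms , qr = ∈-filter⁻ (quasirandom? {k} {s} ℓ) {xs = perms k} π∈ in perms-sound k π∈perms , qr) σ∈ π∈))

  L-large : (m ∸ 1) * n ! ≤ m * length L
  L-large = complement-bound m (trans (length-filter-complement (someGood? s (t * k) Q) (perms n)) (length-perms n))
    (m*length-badPerms≤n! s (t * k) m Q (subst ((k + s) * 6 ≤_) (sym H≡10k) R*6≤H) (≤-trans (s≤s z≤n) W≤M)
      (≤-trans n≤W W≤M) (≤-trans (n≤1+n _) W≤M)
      (subst (λ C → 4 * m * (C * ((k + s) * suc C)) ≤ 64 ^ s) (sym C≡k+k) runs≤)
      (subst (λ C → 4 * m * (length Q * 2 ^ (s * C)) ≤ 64 ^ (t * k)) (sym C≡k+k)
        (weights≤ (≤-trans (length-filter (quasirandom? {k} {s} ℓ) (perms k)) (≤-reflexive (length-perms k))))))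
    where
    -- Makes the alphabet exceed `2 n^2`, so that at least half of the words have distinct letters.
    W = suc (2 * (n * n))
    W≤M : W ≤ (k + s) * W
    W≤M = ≤-trans (≤-reflexive (sym (+-identityʳ W))) (*-monoˡ-≤ W (≤-trans k>0 (m≤m+n k s)))
    n≤W : n ≤ W
    n≤W = ≤-trans (n≤n*n n) (≤-trans (m≤m+n (n * n) _) (n≤1+n _))
      where
      n≤n*n : ∀ n → n ≤ n * n
      n≤n*n zero    = z≤n
      n≤n*n (suc n) = m≤m+n _ _

-- These parameters are functions of `k` alone, so the set of patterns is fixed before the precision
-- `m`.
shifts : ℕ → ℕ
shifts k = 2 * bits k

threshold : ℕ → ℕ
threshold k = k / suc (2 * (shifts k * shifts k))

universality : ∀ m k n → (k + k) * (10 * k) ≡ n → 2 ^ (4 * m + 128) ≤ k →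
  let Q = quasirandomPerms k (shifts k) (threshold k) in
  ((m ∸ 1) * (k !) ≤ m * length Q) ×
  (Σ (List (Vec (Fin n) n)) λ L →
    Unique L × All IsPerm L × All (λ σ → All (λ π → Contains σ π) Q) L × ((m ∸ 1) * (n !) ≤ m * length L))
universality m k n C*H≡n K≤k = Q-large , L , L-unique , L-perms , L-contain , L-large
  where
  k>0 : 0 < k
  k>0 = ≤-trans (m^n>0 2 (4 * m + 128)) K≤k
  bits-large : 4 * m + 128 ≤ bits k
  bits-large = ≮⇒≥ (λ p → <⇒≱ (≤-trans (n<2^bits k) (^-monoʳ-≤ 2 (<⇒≤ p))) K≤k)
  double : ∀ k → 2 * (k + k) ≡ 4 * k
  double = solve-∀
  2^bits≤4k : 2 ^ bits k ≤ 4 * k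
  2^bits≤4k = ≤-trans (2^bits≤ k) (≤-trans (*-monoʳ-≤ 2 (+-monoˡ-≤ k k>0)) (≤-reflexive (double k)))
  open Universality k (bits k) m (k + k) (10 * k) n refl refl C*H≡n k>0 (n<2^bits k) 2^bits≤4k
    (≤-trans (m≤n+m 128 (4 * m)) bits-large) (≤-trans (m≤m+n (4 * m) 128) bits-large)

theorem1p3 : Σ ((k : ℕ) → List (Vec (Fin k) k)) λ Q →
    ((k : ℕ) → Unique (Q k) × All IsPerm (Q k)) ×
    ((m : ℕ) → 1 ≤ m → Σ ℕ λ K → (k : ℕ) → K ≤ k →
    ((m ∸ 1) * (k !) ≤ m * length (Q k)) ×
    (Σ (List (Vec (Fin (len k)) (len k))) λ L →
    Unique L × All IsPerm L ×
    All (λ σ → All (λ π → Contains σ π) (Q k)) L ×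
    ((m ∸ 1) * (len k !) ≤ m * length L)))
theorem1p3 = (λ k → quasirandomPerms k (shifts k) (threshold k)) ,
  (λ k → Unique.filter⁺ (quasirandom? (threshold k)) (perms-unique k) ,
    All.tabulate (λ π∈ → perms-sound k (proj₁ (∈-filter⁻ (quasirandom? (threshold k)) {xs = perms k} π∈)))) ,
  -- From here on `bits k` is at least `4 * m`, which pays for the factor `4 * m`, and at least 128,
  -- where `t ^ 11 ≤ 2 ^ t` is available.
  (λ m _ → 2 ^ (4 * m + 128) , λ k K≤k → universality m k (len k) (C*H≡len k) K≤k)
  where
  C*H≡len : ∀ k → (k + k) * (10 * k) ≡ 20 * (k * k)
  C*H≡len = solve-∀
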